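{- Let $F$ be a Boolean formula of size $s$ computing a Boolean function $g:\{0,1\}^k\to\{0,1\}$, built from gates $\wedge,\vee,\oplus$ of arbitrary fan-in. Let $f_1,\dots,f_k$ be functions $f_i:\{0,1\}^n\times\{0,1\}^n\to\{0,1\}$ (each evaluated on parts of Alice's and Bob's inputs) with $GH(f_i)\le c$ for all $i$. Then for every constant $\epsilon>0$, $GH(g(f_1,\dots,f_k))\le O(s^{1+\epsilon}\cdot c)$ (the constant in the $O$ depending only on $\epsilon$).
   Context: A Boolean formula is a Boolean circuit in which every gate has fan-out 1 (a tree); its size is its number of leaves. Garden-hose model: Alice holds $x$, Bob holds $y$. A garden-hose protocol of size $s$ consists of a set $V$ of $s$ vertices (pipes) and an extra vertex $t$ (the tap), together with an assignment of a matching $E_A(x)$ on $V\cup\{t\}$ to every input $x$ of Alice and a matching $E_B(y)$ on $V$ to every input $y$ of Bob. In the graph $(V\cup\{t\},E_A(x)\cup E_B(y))$ every vertex has degree at most 2, so there is a unique maximal path starting at $t$; the output on $(x,y)$ is the parity of the number of edges of this path. The protocol computes a function if the output equals the function value for all inputs. $GH(h)$ is the minimum size of a garden-hose protocol computing $h$. -}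

module Defs where

open import Data.Nat using (ℕ; zero; suc; _≤_)
open import Data.Bool using (Bool; true; false; _∧_; _∨_; _xor_; if_then_else_)
open import Data.Fin using (Fin; zero; suc; _≟_)
open import Data.Maybe using (Maybe; just; nothing)
open import Data.List using (List; []; _∷_)
open import Data.Vec using (Vec)
open import Data.Product using (_×_; Σ; ∃)
open import Relation.Binary.PropositionalEquality using (_≡_; _≢_)
open import Relation.Nullary using (yes; no)

data Gate : Set where
  AND OR XOR : Gate

data Formula (k : ℕ) : Set where
  var  : Fin k → Formula k
  gate : Gate → Formula k → List (Formula k) → Formula k

mutual
  size : ∀ {k} → Formula k → ℕ
  size (var i)       = 1
  size (gate g f fs) = size f Data.Nat.+ sizes fs

  sizes : ∀ {k} → List (Formula k) → ℕ
  sizes []       = 0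
  sizes (f ∷ fs) = size f Data.Nat.+ sizes fs

op : Gate → Bool → Bool → Bool
op AND = _∧_
op OR  = _∨_
op XOR = _xor_

mutual
  eval : ∀ {k} → Formula k → (Fin k → Bool) → Bool
  eval (var i)       a = a i
  eval (gate g f fs) a = evals g (eval f a) fs a

  evals : ∀ {k} → Gate → Bool → List (Formula k) → (Fin k → Bool) → Bool
  evals g acc []       a = acc
  evals g acc (f ∷ fs) a = evals g (op g acc (eval f a)) fs a

-- Garden-hose model.
-- Vertices: Fin (suc s); zero is the tap t, suc i is pipe i ∈ V = Fin s.

IsMatching : ∀ {m} → (Fin m → Maybe (Fin m)) → Set
IsMatching {m} μ = ∀ (u v : Fin m) → μ u ≡ just v → (μ v ≡ just u) × (u ≢ v)

liftB : ∀ {s} → (Fin s → Maybe (Fin s)) → Fin (suc s) → Maybe (Fin (suc s))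
liftB μ zero    = nothing
liftB μ (suc i) with μ i
... | just j  = just (suc j)
... | nothing = nothing

-- Follow the unique maximal path from the tap in the graph
-- (V ∪ {t}, E_A ∪ E_B).  Since E_A, E_B are matchings, the path alternates
-- between an E_A-edge and an E_B-edge; it stops when the current vertex has
-- no further edge (an edge lying in both E_A and E_B is a single edge of the
-- union, hence the test "next ≠ previous").  The result is the parity of the
-- number of edges of the path (true = odd).  Fuel: the path has at most
-- s edges, fuel s+1 suffices.
walk : ∀ {m} → ℕ → (Fin m → Maybe (Fin m)) → (Fin m → Maybe (Fin m))
     → Fin m → Fin m → Bool
walk zero    μ ν prev v = false
walk (suc n) μ ν prev v with μ v
... | nothing = false
... | just w with w ≟ prev
...   | yes _ = false
...   | no  _ = Data.Bool.not (walk n ν μ v w)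

pathParity : ∀ {s} → (Fin (suc s) → Maybe (Fin (suc s)))
           → (Fin (suc s) → Maybe (Fin (suc s))) → Bool
pathParity {s} μA μB with μA zero
... | nothing = false
... | just w  = Data.Bool.not (walk (suc s) μB μA zero w)

record GHProtocol (X Y : Set) (s : ℕ) : Set where
  field
    EA   : X → Fin (suc s) → Maybe (Fin (suc s))
    EB   : Y → Fin s → Maybe (Fin s)
    EA-matching : ∀ x → IsMatching (EA x)
    EB-matching : ∀ y → IsMatching (EB y)

output : ∀ {X Y s} → GHProtocol X Y s → X → Y → Bool
output P x y = pathParity (GHProtocol.EA P x) (liftB (GHProtocol.EB P y))

Computes : ∀ {X Y s} → GHProtocol X Y s → (X → Y → Bool) → Set
Computes P h = ∀ x y → output P x y ≡ h x y

GH≤ : ∀ {X Y : Set} → (X → Y → Bool) → ℕ → Set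
GH≤ {X} {Y} h b = Σ ℕ λ s → s ≤ b × Σ (GHProtocol X Y s) λ P → Computes P h

compose : ∀ {k n} → Formula k → (Fin k → Vec Bool n → Vec Bool n → Bool)
        → Vec Bool n → Vec Bool n → Bool
compose F f x y = eval F (λ i → f i x y)

{-# OPTIONS --safe #-}

-- A formula of size s is computed by a straight-line program over GF(2) with
-- boundedly many registers and O(s^(1+ε)) instructions of the form v += u or
-- v += u · fᵢ.  Each instruction is a controlled involution of the finitely
-- many register contents, and a copy of the protocol for fᵢ per content (and
-- a few mirror copies, which lead the path back) turns it into O(c) pipes.
--
-- For the program, cut a formula of size at most 2^d · M into a number of
-- pieces depending only on d, of size at most M; with a fresh register per
-- piece, each leaf is then needed once.  The registers are not fresh, but by
-- linearity a commutator using every piece 4 times cancels their initial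
-- contents and the garbage.  The recursion thus costs a factor 4 whenever the
-- size shrinks by a factor 2^d, hence s^(1 + 2/d) in total.
module Submission where

open import Defs
import Algebra.Properties.CommutativeSemigroup as CommutativeSemigroupProperties
open import Data.Bool using (Bool; true; false; _∧_; _xor_; not; if_then_else_)
open import Data.Bool.Properties using
  ( ∧-identityʳ; ∧-zeroʳ; ∧-comm; ∧-distribʳ-xor; ∨-comm; not-involutive; not-distribˡ-xor
  ; xor-assoc; xor-comm; xor-identityʳ; xor-same)
open import Data.Bool.Solver using (module xor-∧-Solver)
import Data.Fin as Fin
open import Data.Fin using (Fin; zero; suc)
open import Data.Fin.Permutation using (transpose)
open import Data.Fin.Properties using (injective⇒≤; +↔⊎; *↔×; 2↔Bool)
import Data.List as List
open import Data.List using (List; []; _∷_; _++_; length; lookup)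
open import Data.List.Membership.Propositional using (_∈_; _∉_)
open import Data.List.Membership.Propositional.Properties using (∈-lookup)
open import Data.List.Properties using (length-++; length-map)
import Data.List.Relation.Unary.All as All
open import Data.List.Relation.Unary.All using (All; []; _∷_)
open import Data.List.Relation.Unary.All.Properties using (++⁺; map⁺; ¬Any⇒All¬)
open import Data.List.Relation.Unary.AllPairs using ([]; _∷_)
open import Data.List.Relation.Unary.Any using (here; there)
open import Data.List.Relation.Unary.Unique.Propositional using (Unique)
open import Data.Maybe using (Maybe; just; nothing; map; maybe′)
open import Data.Maybe.Properties using (just-injective)
open import Data.Nat using (ℕ; zero; suc; _≤_; _<_; _+_; _*_; _∸_; _^_; z≤n; s≤s; _≟_; _≤?_)
open import Data.Nat.Properties hiding (_≟_)
open import Data.Nat.Solver using (module +-*-Solver)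
open import Data.Product using (Σ; _×_; _,_; ∃; proj₁; proj₂; swap)
open import Data.Product.Function.NonDependent.Propositional using (_×-↔_)
open import Data.Sum using (_⊎_; inj₁; inj₂)
open import Data.Sum.Function.Propositional using (_⊎-↔_)
open import Data.Vec using (Vec; []; _∷_; replicate)
open import Function using (_↔_; Inverse; mk↔ₛ′; _∘_)
open import Function.Construct.Composition using (_↔-∘_)
open import Function.Construct.Identity using (↔-id)
open import Relation.Binary.PropositionalEquality
open import Relation.Nullary using (yes; no; contradiction; does)
open import Relation.Nullary.Decidable using (dec-true; dec-false)

-- Every gate is affine over GF(2) in each argument, so a formula with a hole acts affinely on the
-- hole; a register s in the role of the constant 1 makes this action linear. The obstacle is a
-- heavy subtree inside a chain: it enters as a coefficient of a running value, yet no instruction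
-- multiplies two registers. Hence a tree is never evaluated alone, but always together with a
-- factor q: with q in the role of s, the product is again computed by chains.
--
-- The second obstacle is space: the number of gadgets per instruction is exponential in the number
-- of registers, which must not grow with s. Nested calls therefore alternate between two banks; a
-- call takes the other bank as scratch space, whatever it holds, and restores it. Reversibility is
-- forced by the model: the connections between gadgets are edges of a matching, so an instruction
-- must be an involution for either value of its guard.

data Tree (k : ℕ) : Set where
  leaf : Fin k → Tree k
  node : Gate → Tree k → Tree k → Tree k

leaves : ∀ {k} → Tree k → ℕ
leaves (leaf i)     = 1
leaves (node g l r) = leaves l + leaves r

value : ∀ {k} → Tree k → (Fin k → Bool) → Bool
value (leaf i)     a = a i
value (node g l r) a = op g (value l a) (value r a)

mutual
  binarise : ∀ {k} → Formula k → Tree k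
  binarise (var i)       = leaf i
  binarise (gate g f fs) = binarises g (binarise f) fs

  binarises : ∀ {k} → Gate → Tree k → List (Formula k) → Tree k
  binarises g t []       = t
  binarises g t (f ∷ fs) = binarises g (node g t (binarise f)) fs

mutual
  leaves-binarise : ∀ {k} (F : Formula k) → leaves (binarise F) ≡ size F
  leaves-binarise (var i)       = refl
  leaves-binarise (gate g f fs) =
    trans (leaves-binarises g (binarise f) fs) (cong (_+ sizes fs) (leaves-binarise f))

  leaves-binarises : ∀ {k} g (t : Tree k) fs → leaves (binarises g t fs) ≡ leaves t + sizes fs
  leaves-binarises g t []       = sym (+-identityʳ (leaves t))
  leaves-binarises g t (f ∷ fs) = begin
    leaves (binarises g (node g t (binarise f)) fs) ≡⟨ leaves-binarises g _ fs ⟩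
    (leaves t + leaves (binarise f)) + sizes fs
      ≡⟨ cong (λ z → (leaves t + z) + sizes fs) (leaves-binarise f) ⟩
    (leaves t + size f) + sizes fs                  ≡⟨ +-assoc (leaves t) (size f) (sizes fs) ⟩
    leaves t + (size f + sizes fs)                  ∎
    where open ≡-Reasoning

mutual
  value-binarise : ∀ {k} (F : Formula k) a → value (binarise F) a ≡ eval F a
  value-binarise (var i)       a = refl
  value-binarise (gate g f fs) a =
    trans (value-binarises g (binarise f) fs a)
          (cong (λ z → evals g z fs a) (value-binarise f a))

  value-binarises : ∀ {k} g (t : Tree k) fs a →
    value (binarises g t fs) a ≡ evals g (value t a) fs a
  value-binarises g t []       a = refl
  value-binarises g t (f ∷ fs) a =
    trans (value-binarises g (node g t (binarise f)) fs a)
          (cong (λ z → evals g (op g (value t a) z) fs a) (value-binarise f a))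

leaves-positive : ∀ {k} (t : Tree k) → 1 ≤ leaves t
leaves-positive (leaf i)     = ≤-refl
leaves-positive (node g l r) = ≤-trans (leaves-positive l) (m≤m+n _ _)

-- No gate negates. This serves the case c = 0, where all the functions plugged in are constantly
-- false.
value-zero : ∀ {k} (t : Tree k) a → (∀ i → a i ≡ false) → value t a ≡ false
value-zero (leaf i)       a z = z i
value-zero (node g l r) a z rewrite value-zero l a z | value-zero r a z with g
... | AND = refl
... | OR  = refl
... | XOR = refl

-- Chains and their decomposition into light pieces

-- A chain is a formula with one hole: starting from the hole, combine the
-- running value with each subtree in turn.  Over GF(2) it acts on the hole
-- affinely, u ↦ A u + B; act is the homogenised form (u , s) ↦ A u + B s.
Chain : ℕ → Set
Chain k = List (Gate × Tree k)

chainLeaves : ∀ {k} → Chain k → ℕ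
chainLeaves []            = 0
chainLeaves ((g , t) ∷ c) = leaves t + chainLeaves c

-- The coefficients in `op g u x` = `summand` + `factor` · x, with s standing for 1; for `OR` this
-- is u + (u + 1) x.
summand factor : Gate → Bool → Bool → Bool
summand AND u s = false
summand XOR u s = u
summand OR  u s = u
factor AND u s = u
factor XOR u s = s
factor OR  u s = u xor s

act : ∀ {k} → (Fin k → Bool) → Chain k → Bool → Bool → Bool
act a []            u s = u
act a ((g , t) ∷ c) u s = act a c (summand g u s xor (factor g u s ∧ value t a)) s

chainLeaves-++ : ∀ {k} (c d : Chain k) → chainLeaves (c ++ d) ≡ chainLeaves c + chainLeaves d
chainLeaves-++ []            d = refl
chainLeaves-++ ((g , t) ∷ c) d =
  trans (cong (leaves t +_) (chainLeaves-++ c d)) (sym (+-assoc (leaves t) _ _))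

act-++ : ∀ {k} a (c d : Chain k) u s → act a (c ++ d) u s ≡ act a d (act a c u s) s
act-++ a []            d u s = refl
act-++ a ((g , t) ∷ c) d u s = act-++ a c d _ s

xor-interchange : ∀ p q r s → (p xor q) xor (r xor s) ≡ (p xor r) xor (q xor s)
xor-interchange = solve 4 (λ p q r s → (p :+ q) :+ (r :+ s) := (p :+ r) :+ (q :+ s)) refl
  where open xor-∧-Solver

-- The values of the subtrees do not depend on u and s, and the homogenised step has no constant
-- term. `exec-⊞`, and with it the commutator, rests on this.
act-linear : ∀ {k} a (c : Chain k) u u′ s s′ →
  act a c (u xor u′) (s xor s′) ≡ act a c u s xor act a c u′ s′
act-linear a []            u u′ s s′ = refl
act-linear a ((g , t) ∷ c) u u′ s s′ =
  trans (cong (λ z → act a c z (s xor s′)) (step g (value t a)))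
        (act-linear a c _ _ s s′)
  where
  open xor-∧-Solver
  step : ∀ g x → summand g (u xor u′) (s xor s′) xor (factor g (u xor u′) (s xor s′) ∧ x)
       ≡ (summand g u s xor (factor g u s ∧ x)) xor (summand g u′ s′ xor (factor g u′ s′ ∧ x))
  step AND x = solve 3 (λ u u′ x → (u :+ u′) :* x := u :* x :+ u′ :* x) refl u u′ x
  step XOR x = solve 5 (λ u u′ s s′ x →
    (u :+ u′) :+ (s :+ s′) :* x := (u :+ s :* x) :+ (u′ :+ s′ :* x)) refl u u′ s s′ x
  step OR  x = solve 5 (λ u u′ s s′ x →
    (u :+ u′) :+ ((u :+ u′) :+ (s :+ s′)) :* x := (u :+ (u :+ s) :* x) :+ (u′ :+ (u′ :+ s′) :* x))
    refl u u′ s s′ x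

-- With q in place of 1, a step takes q times one argument to q times the gate's value. So q · t is
-- computed by chains, without ever multiplying two registers.
gate-act : ∀ g x y q →
  summand g (q ∧ x) q xor (factor g (q ∧ x) q ∧ y) ≡ q ∧ op g x y
gate-act AND true  y true  = refl
gate-act AND false y true  = refl
gate-act XOR x     y true  = refl
gate-act OR  true  y true  = refl
gate-act OR  false y true  = refl
gate-act AND x     y false = refl
gate-act XOR x     y false = refl
gate-act OR  x     y false = refl

op-comm : ∀ g x y → op g x y ≡ op g y x
op-comm AND = ∧-comm
op-comm OR  = ∨-comm
op-comm XOR = xor-comm

-- The cut is at the tree where the leaf count first passes M. In a chain of at most 2 M leaves both
-- sides of it are then light; the tree itself may still be heavy.
data Split {k} (M : ℕ) : Chain k → Set where
  allLight : ∀ {c} → chainLeaves c ≤ M → Split M c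
  heavyAt : ∀ c₁ g t c₂ → chainLeaves c₁ ≤ M → M < chainLeaves c₁ + leaves t →
          Split M (c₁ ++ (g , t) ∷ c₂)

split : ∀ {k} M (c : Chain k) → Split M c
split M []            = allLight z≤n
split M ((g , t) ∷ c) with leaves t ≤? M
... | no  t≰M = heavyAt [] g t c z≤n (≰⇒> t≰M)
... | yes t≤M with split (M ∸ leaves t) c
...   | allLight c≤ = allLight (≤-trans (+-monoʳ-≤ (leaves t) c≤) (≤-reflexive (m+[n∸m]≡n t≤M)))
...   | heavyAt c₁ h t′ c₂ c₁≤ M< = heavyAt ((g , t) ∷ c₁) h t′ c₂
          (≤-trans (+-monoʳ-≤ (leaves t) c₁≤) (≤-reflexive (m+[n∸m]≡n t≤M)))
          (≤-trans (≤-reflexive (sym (trans (+-suc (leaves t) (M ∸ leaves t)) (cong suc (m+[n∸m]≡n t≤M)))))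
                   (≤-trans (+-monoʳ-≤ (leaves t) M<)
                            (≤-reflexive (sym (+-assoc (leaves t) (chainLeaves c₁) (leaves t′))))))

+-light : ∀ {M m n} → M < m → m + n ≤ 2 * M → n ≤ M
+-light {M} {m} {n} M<m m+n≤ = +-cancelˡ-≤ M n M
  (≤-trans (+-monoˡ-≤ n (<⇒≤ M<m)) (≤-trans m+n≤ (≤-reflexive (cong (M +_) (+-identityʳ M)))))

-- A tree multiplied by q is a chain acting on the pair (q , q).
record Pieces {k} (M : ℕ) (t : Tree k) : Set where
  field
    c₁ c₂ c₃ : Chain k
    light₁   : chainLeaves c₁ ≤ M
    light₂   : chainLeaves c₂ ≤ M
    light₃   : chainLeaves c₃ ≤ M
    total    : chainLeaves c₁ + (chainLeaves c₂ + chainLeaves c₃) ≡ leaves t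
    correct  : ∀ a q → act a c₃ (act a c₂ (act a c₁ q q) q) q ≡ q ∧ value t a

-- Together the first two pieces exceed M, so the third is light as soon as t
-- has at most 2 M leaves.
record Peeled {k} (M : ℕ) (t : Tree k) : Set where
  field
    c₁ c₂ c₃ : Chain k
    light₁   : chainLeaves c₁ ≤ M
    light₂   : chainLeaves c₂ ≤ M
    heavy₁₂  : M < chainLeaves c₁ + chainLeaves c₂
    total    : chainLeaves c₁ + (chainLeaves c₂ + chainLeaves c₃) ≡ leaves t
    correct  : ∀ a q → act a c₃ (act a c₂ (act a c₁ q q) q) q ≡ q ∧ value t a

-- On the way back up, the sibling of the heavy child becomes the last link of the third chain,
-- whose size is bounded only at the end, by `heavy₁₂`.
extend : ∀ {k M} {t : Tree k} g r t′ → Peeled M t →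
  leaves t′ ≡ leaves t + leaves r → (∀ a → value t′ a ≡ op g (value t a) (value r a)) →
  Peeled M t′
extend {t = t} g r t′ p ℓ≡ v≡ = record
  { c₁ = c₁ ; c₂ = c₂ ; c₃ = c₃ ++ (g , r) ∷ []
  ; light₁ = light₁ ; light₂ = light₂ ; heavy₁₂ = heavy₁₂
  ; total = begin
      x + (y + chainLeaves (c₃ ++ (g , r) ∷ [])) ≡⟨ cong (λ w → x + (y + w)) (chainLeaves-++ c₃ _) ⟩
      x + (y + (z + (leaves r + 0)))
        ≡⟨ cong (λ w → x + (y + (z + w))) (+-identityʳ (leaves r)) ⟩
      x + (y + (z + leaves r))       ≡⟨ cong (x +_) (sym (+-assoc y z (leaves r))) ⟩
      x + ((y + z) + leaves r)       ≡⟨ sym (+-assoc x (y + z) (leaves r)) ⟩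
      (x + (y + z)) + leaves r       ≡⟨ cong (_+ leaves r) total ⟩
      leaves t + leaves r            ≡⟨ sym ℓ≡ ⟩
      leaves t′                      ∎
  ; correct = λ a q → begin
      act a (c₃ ++ (g , r) ∷ []) (act a c₂ (act a c₁ q q) q) q
        ≡⟨ act-++ a c₃ _ _ q ⟩
      act a ((g , r) ∷ []) (act a c₃ (act a c₂ (act a c₁ q q) q) q) q
        ≡⟨ cong (λ w → act a ((g , r) ∷ []) w q) (correct a q) ⟩
      act a ((g , r) ∷ []) (q ∧ value t a) q
        ≡⟨ gate-act g (value t a) (value r a) q ⟩
      q ∧ op g (value t a) (value r a)
        ≡⟨ cong (q ∧_) (sym (v≡ a)) ⟩
      q ∧ value t′ a ∎
  }
  where
  open Peeled p
  open ≡-Reasoning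
  x = chainLeaves c₁
  y = chainLeaves c₂
  z = chainLeaves c₃

-- Descent into a heavy child stops at a heavy node with two light children. These are the first two
-- pieces; the `AND` link turns the initial q into q times the left child.
peel : ∀ {k} M (t : Tree k) → M < leaves t → leaves t ≤ 2 * M → Peeled M t
-- The bound 2 M excludes M = 0, the one case in which a leaf would be heavy.
peel zero    t@(leaf i) M< ()
peel (suc M) (leaf i) (s≤s ()) _
peel M t@(node g l r) M< ≤2M with leaves l ≤? M | leaves r ≤? M
... | no l≰ | _ = extend g r t (peel M l (≰⇒> l≰) (≤-trans (m≤m+n _ _) ≤2M)) refl (λ a → refl)
... | yes _ | no r≰ = extend g l t (peel M r (≰⇒> r≰) (≤-trans (m≤n+m _ _) ≤2M))
                        (+-comm (leaves l) (leaves r)) (λ a → op-comm g (value l a) (value r a))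
... | yes l≤ | yes r≤ = record
  { c₁ = (AND , l) ∷ [] ; c₂ = (g , r) ∷ [] ; c₃ = []
  ; light₁ = ≤-trans (≤-reflexive (+-identityʳ _)) l≤
  ; light₂ = ≤-trans (≤-reflexive (+-identityʳ _)) r≤
  ; heavy₁₂ = ≤-trans M< (≤-reflexive (sym (cong₂ _+_ (+-identityʳ (leaves l)) (+-identityʳ (leaves r)))))
  ; total = cong₂ _+_ (+-identityʳ (leaves l)) (trans (+-identityʳ _) (+-identityʳ (leaves r)))
  ; correct = λ a q → gate-act g (value l a) (value r a) q
  }

pieces : ∀ {k} M (t : Tree k) → leaves t ≤ 2 * M → Pieces M t
pieces M t ≤2M with leaves t ≤? M
... | yes t≤ = record
  { c₁ = (AND , t) ∷ [] ; c₂ = [] ; c₃ = []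
  ; light₁ = ≤-trans (≤-reflexive (+-identityʳ _)) t≤ ; light₂ = z≤n ; light₃ = z≤n
  ; total = trans (+-identityʳ _) (+-identityʳ _) ; correct = λ a q → refl }
... | no t≰ = record
  { c₁ = c₁ ; c₂ = c₂ ; c₃ = c₃ ; light₁ = light₁ ; light₂ = light₂
  ; light₃ = +-light heavy₁₂ (≤-trans (≤-reflexive (trans (+-assoc (chainLeaves c₁) _ _) total)) ≤2M)
  ; total = total ; correct = correct }
  where open Peeled (peel M t (≰⇒> t≰) ≤2M)

-- Straight-line code for chains

Env : Set
Env = ℕ → Bool

put : ℕ → Bool → Env → Env
put t x β r = β r xor (x ∧ does (t ≟ r))

put-same : ∀ t x β → put t x β t ≡ β t xor x
put-same t x β rewrite dec-true (t ≟ t) refl = cong (β t xor_) (∧-identityʳ x)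

put-other : ∀ {t r} x β → t ≢ r → put t x β r ≡ β r
put-other {t} {r} x β t≢r rewrite dec-false (t ≟ r) t≢r =
  trans (cong (β r xor_) (∧-zeroʳ x)) (xor-identityʳ (β r))

-- Code allocating the registers n, …, m − 1 one after the other, each set to
-- the value of a chain, or to a sum, of earlier registers.
data Code (k M : ℕ) : ℕ → ℕ → Set where
  []  : ∀ {n} → Code k M n n
  app : ∀ {n m} (c : Chain k) (u s : ℕ) → chainLeaves c ≤ M → u < n → s < n →
        Code k M (suc n) m → Code k M n m
  sum : ∀ {n m} (u v : ℕ) → u < n → v < n → Code k M (suc n) m → Code k M n m

module _ {k M : ℕ} where

  load : ∀ {n m} → Code k M n m → ℕ
  load []                  = 0
  load (app c u s _ _ _ p) = chainLeaves c + load p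
  load (sum u v _ _ p)     = load p

  -- Registers accumulate, so exec is linear in the initial contents; it only
  -- computes the intended values when the allocated registers start at 0.
  exec : ∀ {n m} → (Fin k → Bool) → Code k M n m → Env → Env
  exec a []                      β = β
  exec {n} a (app c u s _ _ _ p) β = exec a p (put n (act a c (β u) (β s)) β)
  exec {n} a (sum u v _ _ p)     β = exec a p (put n (β u xor β v) β)

  infixr 5 _⊕_
  _⊕_ : ∀ {n m l} → Code k M n m → Code k M m l → Code k M n l
  []                         ⊕ q = q
  app c u s light u< s< p ⊕ q = app c u s light u< s< (p ⊕ q)
  sum u v u< v< p         ⊕ q = sum u v u< v< (p ⊕ q)

  load-⊕ : ∀ {n m l} (p : Code k M n m) (q : Code k M m l) → load (p ⊕ q) ≡ load p + load q
  load-⊕ []                  q = refl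
  load-⊕ (app c u s _ _ _ p) q =
    trans (cong (chainLeaves c +_) (load-⊕ p q)) (sym (+-assoc (chainLeaves c) _ _))
  load-⊕ (sum u v _ _ p)     q = load-⊕ p q

  exec-⊕ : ∀ {n m l} a (p : Code k M n m) (q : Code k M m l) β →
    exec a (p ⊕ q) β ≡ exec a q (exec a p β)
  exec-⊕ a []                  q β = refl
  exec-⊕ a (app c u s _ _ _ p) q β = exec-⊕ a p q _
  exec-⊕ a (sum u v _ _ p)     q β = exec-⊕ a p q _

  code-≤ : ∀ {n m} → Code k M n m → n ≤ m
  code-≤ []                  = ≤-refl
  code-≤ (app c u s _ _ _ p) = ≤-trans (n≤1+n _) (code-≤ p)
  code-≤ (sum u v _ _ p)     = ≤-trans (n≤1+n _) (code-≤ p)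

  exec-below : ∀ {n m} a (p : Code k M n m) β {r} → r < n → exec a p β r ≡ β r
  exec-below a []                  β r< = refl
  exec-below a (app c u s _ _ _ p) β r< =
    trans (exec-below a p _ (m<n⇒m<1+n r<)) (put-other _ β (>⇒≢ r<))
  exec-below a (sum u v _ _ p)     β r< =
    trans (exec-below a p _ (m<n⇒m<1+n r<)) (put-other _ β (>⇒≢ r<))

  exec-above : ∀ {n m} a (p : Code k M n m) β {r} → m ≤ r → exec a p β r ≡ β r
  exec-above a []                  β ≤r = refl
  exec-above a (app c u s _ _ _ p) β ≤r =
    trans (exec-above a p _ ≤r) (put-other _ β (<⇒≢ (≤-trans (code-≤ p) ≤r)))
  exec-above a (sum u v _ _ p)     β ≤r =
    trans (exec-above a p _ ≤r) (put-other _ β (<⇒≢ (≤-trans (code-≤ p) ≤r)))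

-- `L` bounds the registers allocated from `n` on, `N` the leaves loaded; φ gives the result in
-- terms of the initial environment. `out` may be an old register, so passing a value on costs
-- nothing.
record Plan {k : ℕ} (M L n N : ℕ) (φ : (Fin k → Bool) → Env → Bool) : Set where
  field
    top out : ℕ
    code    : Code k M n top
    top≤    : top ≤ n + L
    out<    : out < top
    load≤   : load code ≤ N
    correct : ∀ a ρ → (∀ r → n ≤ r → ρ r ≡ false) → exec a code ρ out ≡ φ a ρ

module _ {k M : ℕ} where

  appPlan : ∀ {n u s} (c : Chain k) → chainLeaves c ≤ M → u < n → s < n →
    Plan M 1 n (chainLeaves c) (λ a ρ → act a c (ρ u) (ρ s))
  appPlan {n} {u} {s} c light u< s< = record
    { top = suc n ; out = n ; code = app c u s light u< s< []
    ; top≤ = ≤-reflexive (sym (+-comm n 1)) ; out< = ≤-refl ; load≤ = ≤-reflexive (+-identityʳ _)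
    ; correct = λ a ρ z → trans (put-same n _ ρ) (cong (_xor act a c (ρ u) (ρ s)) (z n ≤-refl)) }

  sumPlan : ∀ {n u v} → u < n → v < n → Plan {k} M 1 n 0 (λ a ρ → ρ u xor ρ v)
  sumPlan {n} {u} {v} u< v< = record
    { top = suc n ; out = n ; code = sum u v u< v< []
    ; top≤ = ≤-reflexive (sym (+-comm n 1)) ; out< = ≤-refl ; load≤ = z≤n
    ; correct = λ a ρ z → trans (put-same n _ ρ) (cong (_xor (ρ u xor ρ v)) (z n ≤-refl)) }

  copyPlan : ∀ {n u} → u < n → Plan {k} M 0 n 0 (λ a ρ → ρ u)
  copyPlan {n} {u} u< = record
    { top = n ; out = u ; code = [] ; top≤ = ≤-reflexive (sym (+-identityʳ n)) ; out< = u<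
    ; load≤ = z≤n ; correct = λ a ρ z → refl }

  relax : ∀ {L L′ n N N′ φ φ′} → L ≤ L′ → N ≤ N′ → (∀ a ρ → φ a ρ ≡ φ′ a ρ) →
    Plan {k} M L n N φ → Plan M L′ n N′ φ′
  relax {n = n} L≤ N≤ φ≡ p = record
    { top = top ; out = out ; code = code ; top≤ = ≤-trans top≤ (+-monoʳ-≤ n L≤)
    ; out< = out< ; load≤ = ≤-trans load≤ N≤
    ; correct = λ a ρ z → trans (correct a ρ z) (φ≡ a ρ) }
    where open Plan p

  -- Only the first plan knows where it stops, hence a continuation for every m. Of the environment
  -- ρ′ left to it, just the registers below n and the result x are known.
  bind : ∀ {L L′ n N N′ φ} {ψ : ℕ → (Fin k → Bool) → Env → Bool} {χ} →
    Plan {k} M L n N φ →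
    (∀ {m} x → n ≤ m → x < m → Plan M L′ m N′ (ψ x)) →
    (∀ x a ρ ρ′ → (∀ {r} → r < n → ρ′ r ≡ ρ r) → ρ′ x ≡ φ a ρ → ψ x a ρ′ ≡ χ a ρ) →
    Plan M (L + L′) n (N + N′) χ
  bind {L} {L′} {n} p f ψχ = record
    { top = Q.top ; out = Q.out ; code = P.code ⊕ Q.code
    ; top≤ = ≤-trans Q.top≤ (≤-trans (+-monoˡ-≤ L′ P.top≤) (≤-reflexive (+-assoc n L L′)))
    ; out< = Q.out<
    ; load≤ = ≤-trans (≤-reflexive (load-⊕ P.code Q.code)) (+-mono-≤ P.load≤ Q.load≤)
    ; correct = λ a ρ z →
        trans (cong (λ β → β Q.out) (exec-⊕ a P.code Q.code ρ))
        (trans (Q.correct a _ (λ r ≤r → trans (exec-above a P.code ρ ≤r)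
                                              (z r (≤-trans (code-≤ P.code) ≤r))))
               (ψχ P.out a ρ _ (λ r< → exec-below a P.code ρ r<) (P.correct a ρ z))) }
    where
    module P = Plan p
    module Q = Plan (f P.out (code-≤ P.code) P.out<)

  factorPlan : ∀ {n u s} g → u < n → s < n → Plan {k} M 1 n 0 (λ a ρ → factor g (ρ u) (ρ s))
  factorPlan AND u< s< = relax z≤n ≤-refl (λ a ρ → refl) (copyPlan u<)
  factorPlan XOR u< s< = relax z≤n ≤-refl (λ a ρ → refl) (copyPlan s<)
  factorPlan OR  u< s< = sumPlan u< s<

  summandPlan : ∀ {n u s x} g → u < n → x < n →
    Plan {k} M 1 n 0 (λ a ρ → summand g (ρ u) (ρ s) xor ρ x)
  summandPlan AND u< x< = relax z≤n ≤-refl (λ a ρ → refl) (copyPlan x<)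
  summandPlan XOR u< x< = sumPlan u< x<
  summandPlan OR  u< x< = sumPlan u< x<

-- Five chains of half the size, namely both sides of the cut and three pieces of the heavy tree,
-- plus one register each for `factor` and `summand`. The nesting is that of the `bind`s in `plan`.
codeLength : ℕ → ℕ
codeLength zero    = 1
codeLength (suc d) = ℓ + (1 + ((ℓ + (ℓ + (ℓ + 0))) + (1 + ℓ)))
  where ℓ = codeLength d

-- The size is halved d times. At a heavy tree t the code computes v by c₁, then q = `factor`, x = q
-- · t, w = `summand` + x, and finally c₂ on w. No leaf is used twice, so the load is at most the
-- number of leaves.
plan : ∀ {k} d M (c : Chain k) {n u s} → chainLeaves c ≤ 2 ^ d * M → u < n → s < n →
  Plan M (codeLength d) n (chainLeaves c) (λ a ρ → act a c (ρ u) (ρ s))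
plan zero    M c light u< s< = appPlan c (≤-trans light (≤-reflexive (+-identityʳ M))) u< s<
plan {k} (suc d) M c {n} {u} {s} c≤ u< s< with split (2 ^ d * M) c
... | allLight c≤′ = relax (m≤m+n (codeLength d) _) ≤-refl (λ a ρ → refl) (plan d M c c≤′ u< s<)
... | heavyAt c₁ g t c₂ c₁≤ <c₁+t =
  relax ≤-refl leaves≤ (λ a ρ → sym (act-++ a c₁ ((g , t) ∷ c₂) (ρ u) (ρ s)))
    (bind (plan d M c₁ c₁≤ u< s<)
      (λ v ≤m v< → bind (factorPlan g v< (<-≤-trans s< ≤m))
        (λ q ≤m′ q< → bind (chunks q<)
          (λ x ≤m″ x< → bind (summandPlan {s = s} g (<-≤-trans v< (≤-trans ≤m′ ≤m″)) x<)
            (λ w ≤m‴ w< → plan d M c₂ c₂≤ w< (<-≤-trans s< (≤-trans ≤m (≤-trans ≤m′ (≤-trans ≤m″ ≤m‴)))))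
            λ w a ρ ρ′ old new → cong₂ (act a c₂) new (old (<-≤-trans s< (≤-trans ≤m (≤-trans ≤m′ ≤m″)))))
          λ x a ρ ρ′ old new → cong₂ (act a c₂)
            (cong₂ _xor_ (cong₂ (summand g) (old (<-≤-trans v< ≤m′)) (old (<-≤-trans s< (≤-trans ≤m ≤m′)))) new)
            (old (<-≤-trans s< (≤-trans ≤m ≤m′))))
        λ q a ρ ρ′ old new → cong₂ (λ y z → act a c₂ y z)
          (cong₂ _xor_ (cong₂ (summand g) (old v<) (old (<-≤-trans s< ≤m)))
                       (cong (_∧ value t a) new)) (old (<-≤-trans s< ≤m)))
      λ v a ρ ρ′ old new → cong₂ (λ y z → act a ((g , t) ∷ c₂) y z) new (old s<))
  where
  open ≡-Reasoning
  assoc′ : chainLeaves (c₁ ++ (g , t) ∷ c₂) ≡ (chainLeaves c₁ + leaves t) + chainLeaves c₂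
  assoc′ = trans (chainLeaves-++ c₁ _) (sym (+-assoc (chainLeaves c₁) _ _))
  c≤2 : (chainLeaves c₁ + leaves t) + chainLeaves c₂ ≤ 2 * (2 ^ d * M)
  c≤2 = ≤-trans (≤-reflexive (sym assoc′)) (≤-trans c≤ (≤-reflexive (*-assoc 2 (2 ^ d) M)))
  c₂≤ : chainLeaves c₂ ≤ 2 ^ d * M
  c₂≤ = +-light <c₁+t c≤2
  module T = Pieces (pieces (2 ^ d * M) t
    (≤-trans (m≤n+m (leaves t) (chainLeaves c₁)) (≤-trans (m≤m+n _ (chainLeaves c₂)) c≤2)))
  -- The register q serves as hole and as homogenising register at once, which yields the product q
  -- ∧ value t.
  chunks : ∀ {m q} → q < m →
    Plan M (codeLength d + (codeLength d + (codeLength d + 0))) m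
      (chainLeaves T.c₁ + (chainLeaves T.c₂ + (chainLeaves T.c₃ + 0))) (λ a ρ → ρ q ∧ value t a)
  chunks {q = q} q< = bind (plan d M T.c₁ T.light₁ q< q<)
    (λ x ≤m x< → bind (plan d M T.c₂ T.light₂ x< (<-≤-trans q< ≤m))
      (λ y ≤m′ y< → bind (plan d M T.c₃ T.light₃ y< (<-≤-trans q< (≤-trans ≤m ≤m′)))
        (λ z _ z< → copyPlan z<)
        λ z a ρ ρ′ old new → new)
      λ y a ρ ρ′ old new → cong₂ (act a T.c₃) new (old (<-≤-trans q< ≤m)))
    λ x a ρ ρ′ old new → trans (cong₂ (λ v w → act a T.c₃ (act a T.c₂ v w) w) new (old q<))
                               (T.correct a (ρ q))
  leaves≤ : chainLeaves c₁ +
      (0 + ((chainLeaves T.c₁ + (chainLeaves T.c₂ + (chainLeaves T.c₃ + 0))) + (0 + chainLeaves c₂)))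
    ≤ chainLeaves (c₁ ++ (g , t) ∷ c₂)
  leaves≤ = ≤-reflexive (begin
    chainLeaves c₁ + ((chainLeaves T.c₁ + (chainLeaves T.c₂ + (chainLeaves T.c₃ + 0))) + chainLeaves c₂)
      ≡⟨ cong (λ z → chainLeaves c₁ + ((chainLeaves T.c₁ + (chainLeaves T.c₂ + z)) + chainLeaves c₂))
              (+-identityʳ _) ⟩
    chainLeaves c₁ + ((chainLeaves T.c₁ + (chainLeaves T.c₂ + chainLeaves T.c₃)) + chainLeaves c₂)
      ≡⟨ cong (λ z → chainLeaves c₁ + (z + chainLeaves c₂)) T.total ⟩
    chainLeaves c₁ + (leaves t + chainLeaves c₂)
      ≡⟨ sym (chainLeaves-++ c₁ _) ⟩
    chainLeaves (c₁ ++ (g , t) ∷ c₂) ∎)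

-- Reversible register programs

infix 4 _≗ₑ_
_≗ₑ_ : Env → Env → Set
β ≗ₑ γ = ∀ i → β i ≡ γ i

infixl 6 _⊞_
_⊞_ : Env → Env → Env
(β ⊞ γ) i = β i xor γ i

put-cong : ∀ t {x y β γ} → x ≡ y → β ≗ₑ γ → put t x β ≗ₑ put t y γ
put-cong t refl β≗γ r = cong (_xor _) (β≗γ r)

put-twice : ∀ t x y β → put t y (put t x β) ≗ₑ put t (x xor y) β
put-twice t x y β r =
  trans (xor-assoc (β r) _ _) (cong (β r xor_) (sym (∧-distribʳ-xor _ x y)))

put-false : ∀ t β → put t false β ≗ₑ β
put-false t β r = xor-identityʳ (β r)

put-cancel : ∀ t {x y} β → x ≡ y → put t y (put t x β) ≗ₑ β
put-cancel t {x} β refl r =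
  trans (put-twice t x x β r) (trans (cong (λ z → put t z β r) (xor-same x)) (put-false t β r))

put-⊞ : ∀ t x y β γ → put t (x xor y) (β ⊞ γ) ≗ₑ put t x β ⊞ put t y γ
put-⊞ t x y β γ r =
  solve 5 (λ b c x y d → (b :+ c) :+ (x :+ y) :* d := (b :+ x :* d) :+ (c :+ y :* d)) refl
    (β r) (γ r) x y (does (t ≟ r))
  where open xor-∧-Solver

module _ {k M : ℕ} (a : Fin k → Bool) where

  -- The target n lies above both operands, so every instruction is its own inverse, and the inverse
  -- of the code is the same instructions in reverse order.
  unexec : ∀ {n m} → Code k M n m → Env → Env
  unexec []                      β = β
  unexec {n} (app c u s _ _ _ p) β = put n (act a c (γ u) (γ s)) γ
    where γ = unexec p β
  unexec {n} (sum u v _ _ p)     β = put n (γ u xor γ v) γ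
    where γ = unexec p β

  exec-cong : ∀ {n m} (p : Code k M n m) {β γ} → β ≗ₑ γ → exec a p β ≗ₑ exec a p γ
  exec-cong []                      e = e
  exec-cong {n} (app c u s _ _ _ p) e = exec-cong p (put-cong n (cong₂ (act a c) (e u) (e s)) e)
  exec-cong {n} (sum u v _ _ p)     e = exec-cong p (put-cong n (cong₂ _xor_ (e u) (e v)) e)

  unexec-cong : ∀ {n m} (p : Code k M n m) {β γ} → β ≗ₑ γ → unexec p β ≗ₑ unexec p γ
  unexec-cong []                      e = e
  unexec-cong {n} (app c u s _ _ _ p) e =
    put-cong n (cong₂ (act a c) (unexec-cong p e u) (unexec-cong p e s)) (unexec-cong p e)
  unexec-cong {n} (sum u v _ _ p)     e =
    put-cong n (cong₂ _xor_ (unexec-cong p e u) (unexec-cong p e v)) (unexec-cong p e)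

  -- Old contents of the bank and newly loaded inputs pass through the code without interacting.
  exec-⊞ : ∀ {n m} (p : Code k M n m) β γ → exec a p (β ⊞ γ) ≗ₑ exec a p β ⊞ exec a p γ
  exec-⊞ []                      β γ i = refl
  exec-⊞ {n} (app c u s _ _ _ p) β γ i = trans
    (exec-cong p (λ r → trans (cong (λ z → put n z (β ⊞ γ) r) (act-linear a c (β u) (γ u) (β s) (γ s)))
                              (put-⊞ n _ _ β γ r)) i)
    (exec-⊞ p _ _ i)
  exec-⊞ {n} (sum u v _ _ p)     β γ i = trans
    (exec-cong p (λ r → trans (cong (λ z → put n z (β ⊞ γ) r) (xor-interchange (β u) (γ u) (β v) (γ v)))
                              (put-⊞ n _ _ β γ r)) i)
    (exec-⊞ p _ _ i)

  unexec-exec : ∀ {n m} (p : Code k M n m) β → unexec p (exec a p β) ≗ₑ β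
  unexec-exec []                          β i = refl
  unexec-exec {n} (app c u s _ u< s< p) β i = trans
    (put-cong n (cong₂ (act a c) (inv u) (inv s)) inv i)
    (put-cancel n β (cong₂ (act a c) (sym (put-other _ β (>⇒≢ u<))) (sym (put-other _ β (>⇒≢ s<)))) i)
    where inv = unexec-exec p (put n (act a c (β u) (β s)) β)
  unexec-exec {n} (sum u v u< v< p)     β i = trans
    (put-cong n (cong₂ _xor_ (inv u) (inv v)) inv i)
    (put-cancel n β (cong₂ _xor_ (sym (put-other _ β (>⇒≢ u<))) (sym (put-other _ β (>⇒≢ v<)))) i)
    where inv = unexec-exec p (put n (β u xor β v) β)

  exec-unexec : ∀ {n m} (p : Code k M n m) β → exec a p (unexec p β) ≗ₑ β
  exec-unexec []                          β i = refl
  exec-unexec {n} (app c u s _ u< s< p) β i = trans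
    (exec-cong p (put-cancel n γ (cong₂ (act a c) (sym (put-other _ γ (>⇒≢ u<)))
                                                  (sym (put-other _ γ (>⇒≢ s<))))) i)
    (exec-unexec p β i)
    where γ = unexec p β
  exec-unexec {n} (sum u v u< v< p)     β i = trans
    (exec-cong p (put-cancel n γ (cong₂ _xor_ (sym (put-other _ γ (>⇒≢ u<)))
                                              (sym (put-other _ γ (>⇒≢ v<))))) i)
    (exec-unexec p β i)
    where γ = unexec p β

-- The Boolean selects one of two banks: a computation into a register of one
-- bank uses the other bank as scratch space.
Reg : Set
Reg = Bool × ℕ

record Instr (k : ℕ) : Set where
  constructor _+=_·_
  field
    target source : Reg
    guard         : Maybe (Fin k)

Store : Set
Store = Env × Env

get : Reg → Store → Bool
get (false , i) (α , β) = α i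
get (true  , i) (α , β) = β i

add : Reg → Bool → Store → Store
add (false , i) x (α , β) = put i x α , β
add (true  , i) x (α , β) = α , put i x β

guardValue : ∀ {k} → (Fin k → Bool) → Maybe (Fin k) → Bool
guardValue a = maybe′ a true

step : ∀ {k} → (Fin k → Bool) → Instr k → Store → Store
step a (t += r · g) σ = add t (get r σ ∧ guardValue a g) σ

Program : ℕ → Set
Program k = List (Instr k)

run : ∀ {k} → (Fin k → Bool) → Program k → Store → Store
run a []      σ = σ
run a (i ∷ p) σ = run a p (step a i σ)

infix 4 _≈_
record _≈_ (σ τ : Store) : Set where
  constructor _,_
  field
    first  : proj₁ σ ≗ₑ proj₁ τ
    second : proj₂ σ ≗ₑ proj₂ τ

≈-refl : ∀ {σ} → σ ≈ σ
≈-refl = (λ _ → refl) , (λ _ → refl)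

≈-swap : ∀ {σ τ} → σ ≈ τ → swap σ ≈ swap τ
≈-swap (e , f) = f , e

≈-trans : ∀ {σ τ υ} → σ ≈ τ → τ ≈ υ → σ ≈ υ
≈-trans (e , f) (e′ , f′) = (λ i → trans (e i) (e′ i)) , (λ i → trans (f i) (f′ i))

get-cong : ∀ r {σ τ} → σ ≈ τ → get r σ ≡ get r τ
get-cong (false , i) (e , f) = e i
get-cong (true  , i) (e , f) = f i

add-cong : ∀ r {x y σ τ} → x ≡ y → σ ≈ τ → add r x σ ≈ add r y τ
add-cong (false , i) x≡y (e , f) = put-cong i x≡y e , f
add-cong (true  , i) x≡y (e , f) = e , put-cong i x≡y f

module _ {k : ℕ} (a : Fin k → Bool) where

  run-cong : ∀ p {σ τ} → σ ≈ τ → run a p σ ≈ run a p τ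
  run-cong []                e = e
  run-cong ((t += r · g) ∷ p) e = run-cong p (add-cong t (cong (_∧ guardValue a g) (get-cong r e)) e)

  run-++ : ∀ p q σ → run a (p ++ q) σ ≡ run a q (run a p σ)
  run-++ []      q σ = refl
  run-++ (i ∷ p) q σ = run-++ p q (step a i σ)

  infixr 5 _▸_
  _▸_ : ∀ {p q σ τ υ} → run a p σ ≈ τ → run a q τ ≈ υ → run a (p ++ q) σ ≈ υ
  _▸_ {p} {q} {σ} e f rewrite run-++ p q σ = ≈-trans (run-cong q e) f

flipReg : Reg → Reg
flipReg (b , i) = not b , i

flip : ∀ {k} → Instr k → Instr k
flip (t += r · g) = flipReg t += flipReg r · g

step-flip : ∀ {k} a (i : Instr k) σ → step a (flip i) (swap σ) ≡ swap (step a i σ)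
step-flip a ((false , _) += (false , _) · g) σ = refl
step-flip a ((false , _) += (true  , _) · g) σ = refl
step-flip a ((true  , _) += (false , _) · g) σ = refl
step-flip a ((true  , _) += (true  , _) · g) σ = refl

-- A program for one bank serves the other as well; the calls to the level below are made with the
-- banks exchanged.
run-flip : ∀ {k} a (p : Program k) σ → run a (List.map flip p) (swap σ) ≡ swap (run a p σ)
run-flip a []      σ = refl
run-flip a (i ∷ p) σ rewrite step-flip a i σ = run-flip a p (step a i σ)

-- The first condition makes the step an involution, the second keeps the write inside the W bits of
-- a bank, beyond which it would be lost.
Admissible : ∀ {k} → ℕ → Instr k → Set
Admissible W (t += r · g) = t ≢ r × proj₂ t < W

flip-admissible : ∀ {k W} {i : Instr k} → Admissible W i → Admissible W (flip i)
flip-admissible {i = (false , _) += (false , _) · g} (t≢r , t<) = (λ { refl → t≢r refl }) , t<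
flip-admissible {i = (false , _) += (true  , _) · g} (t≢r , t<) = (λ ()) , t<
flip-admissible {i = (true  , _) += (false , _) · g} (t≢r , t<) = (λ ()) , t<
flip-admissible {i = (true  , _) += (true  , _) · g} (t≢r , t<) = (λ { refl → t≢r refl }) , t<

-- The other bank may hold arbitrary contents, which are restored.
record Clean {k} (W B : ℕ) (c : Chain k) (v u s : ℕ) : Set where
  field
    program    : Program k
    correct    : ∀ a α β → run a program (α , β) ≈ (put v (act a c (α u) (α s)) α , β)
    length≤    : length program ≤ B
    admissible : All (Admissible W) program

copy : ∀ {k} → Reg → Reg → Instr k
copy t r = t += r · nothing

copy-correct : ∀ {k} (a : Fin k → Bool) t r σ → step a (copy t r) σ ≈ add t (get r σ) σ
copy-correct a t r σ = add-cong t (∧-identityʳ _) ≈-refl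

-- The summand 1 pays for the empty chain, which has no leaves but needs a copy.
CleanUpTo : (k M W A : ℕ) → Set
CleanUpTo k M W A = ∀ (c : Chain k) v u s → chainLeaves c ≤ M → v ≢ u → v ≢ s → v < W →
  Clean W (A * chainLeaves c + 1) c v u s

-- The code acts on the second bank, with the first as scratch. Besides A per leaf, each of the m -
-- n allocated registers costs at most 2 instructions; the bound is stated additively to avoid
-- truncated subtraction.
record Machine {k M : ℕ} (W A : ℕ) {n m} (p : Code k M n m) : Set where
  field
    forward backward : Program k
    forward-correct  : ∀ a α β → run a forward (α , β) ≈ (α , exec a p β)
    backward-correct : ∀ a α β → run a backward (α , β) ≈ (α , unexec a p β)
    forward-length   : length forward + 2 * n ≤ A * load p + 2 * m
    backward-length  : length backward + 2 * n ≤ A * load p + 2 * m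
    forward-admissible  : All (Admissible W) forward
    backward-admissible : All (Admissible W) backward

module _ {k M W A : ℕ} (clean : CleanUpTo k M W A) where

  private
    length-bound : ∀ {x y z} n m ℓ → x ≤ A * z + 2 → y + 2 * suc n ≤ A * ℓ + 2 * m →
      x + y + 2 * n ≤ A * (z + ℓ) + 2 * m
    length-bound {x} {y} {z} n m ℓ x≤ y≤ = begin
      x + y + 2 * n               ≤⟨ +-monoˡ-≤ (2 * n) (+-monoˡ-≤ y x≤) ⟩
      A * z + 2 + y + 2 * n       ≡⟨ solve 3 (λ az y n → az :+ con 2 :+ y :+ con 2 :* n
                                       := az :+ (y :+ con 2 :* (con 1 :+ n))) refl (A * z) y n ⟩
      A * z + (y + 2 * suc n)     ≤⟨ +-monoʳ-≤ (A * z) y≤ ⟩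
      A * z + (A * ℓ + 2 * m)     ≡⟨ solve 4 (λ a z l m → a :* z :+ (a :* l :+ con 2 :* m)
                                       := a :* (z :+ l) :+ con 2 :* m) refl A z ℓ m ⟩
      A * (z + ℓ) + 2 * m         ∎
      where
      open ≤-Reasoning
      open +-*-Solver

    cons : ∀ {n m ℓ} z (x y : Program k) → length x ≤ A * z + 2 →
      length y + 2 * suc n ≤ A * ℓ + 2 * m → length (x ++ y) + 2 * n ≤ A * (z + ℓ) + 2 * m
    cons {n} {m} {ℓ} z x y x≤ y≤ rewrite length-++ x {y} = length-bound {z = z} n m ℓ x≤ y≤

    snoc : ∀ {n m ℓ} z (x y : Program k) → length x ≤ A * z + 2 →
      length y + 2 * suc n ≤ A * ℓ + 2 * m → length (y ++ x) + 2 * n ≤ A * (z + ℓ) + 2 * m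
    snoc {n} {m} {ℓ} z x y x≤ y≤ rewrite length-++ y {x} | +-comm (length y) (length x) =
      length-bound {z = z} n m ℓ x≤ y≤

  -- The program q for one instruction undoes itself, so the backward program uses the same q,
  -- placed last instead of first.
  machine : ∀ {n m} (p : Code k M n m) → m ≤ W → Machine W A p
  machine {n} [] m≤ = record
    { forward = [] ; backward = []
    ; forward-correct = λ a α β → ≈-refl
    ; backward-correct = λ a α β → ≈-refl
    ; forward-length = m≤n+m (2 * n) (A * 0) ; backward-length = m≤n+m (2 * n) (A * 0)
    ; forward-admissible = [] ; backward-admissible = [] }
  machine {n} {m} (app c u s light u< s< p) m≤ = record
    { forward = q ++ R.forward ; backward = R.backward ++ q
    ; forward-correct = λ a α β → _▸_ a {q} {R.forward} (q-correct a α β) (R.forward-correct a α _)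
    ; backward-correct = λ a α β → _▸_ a {R.backward} {q} (R.backward-correct a α β) (q-correct a α _)
    ; forward-length = cons {m = m} (chainLeaves c) q R.forward q≤ R.forward-length
    ; backward-length = snoc {m = m} (chainLeaves c) q R.backward q≤ R.backward-length
    ; forward-admissible = ++⁺ q-admissible R.forward-admissible
    ; backward-admissible = ++⁺ R.backward-admissible q-admissible }
    where
    module R = Machine (machine p m≤)
    module C = Clean (clean c n u s light (>⇒≢ u<) (>⇒≢ s<) (≤-trans (code-≤ p) m≤))
    q = List.map flip C.program
    q-correct : ∀ a α β → run a q (α , β) ≈ (α , put n (act a c (β u) (β s)) β)
    q-correct a α β rewrite run-flip a C.program (β , α) = ≈-swap (C.correct a β α)
    q≤ : length q ≤ A * chainLeaves c + 2
    q≤ rewrite length-map flip C.program = ≤-trans C.length≤ (+-monoʳ-≤ (A * chainLeaves c) (s≤s z≤n))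
    q-admissible : All (Admissible W) q
    q-admissible = map⁺ (All.map (λ {i} → flip-admissible {i = i}) C.admissible)
  machine {n} {m} (sum u v u< v< p) m≤ = record
    { forward = q ++ R.forward ; backward = R.backward ++ q
    ; forward-correct = λ a α β → _▸_ a {q} {R.forward} {α , β} (q-correct a α β) (R.forward-correct a α _)
    ; backward-correct = λ a α β → _▸_ a {R.backward} {q} (R.backward-correct a α β) (q-correct a α (unexec a p β))
    ; forward-length = cons {m = m} 0 q R.forward q≤ R.forward-length
    ; backward-length = snoc {m = m} 0 q R.backward q≤ R.backward-length
    ; forward-admissible = ++⁺ q-admissible R.forward-admissible
    ; backward-admissible = ++⁺ R.backward-admissible q-admissible }
    where
    module R = Machine (machine p m≤)
    q : Program k
    q = copy (true , n) (true , u) ∷ copy (true , n) (true , v) ∷ []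
    q-correct : ∀ a α β → run a q (α , β) ≈ (α , put n (β u xor β v) β)
    q-correct a α β = (λ _ → refl) , λ r → trans
      (put-cong n (trans (∧-identityʳ _) (put-other (β u ∧ true) β (>⇒≢ v<)))
                  (put-cong n {β = β} (∧-identityʳ (β u)) (λ _ → refl)) r)
      (put-twice n (β u) (β v) β r)
    q≤ : 2 ≤ A * 0 + 2
    q≤ = m≤n+m 2 (A * 0)
    q-admissible : All (Admissible W) q
    q-admissible = ((λ { refl → <-irrefl refl u< }) , ≤-trans (code-≤ p) m≤)
                 ∷ ((λ { refl → <-irrefl refl v< }) , ≤-trans (code-≤ p) m≤) ∷ []

-- The recursion on the size of chains

-- Four runs of the code, with 2 instructions per register each, and the six copies made by the two
-- halves of the commutator.
levelOverhead : ℕ → ℕ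
levelOverhead d = 8 * codeLength d + 6

cost : ℕ → ℕ → ℕ
cost d zero    = 3
cost d (suc j) = 4 * cost d j + levelOverhead d

copyClean : ∀ {k W B} v u s → v ≢ u → v < W → Clean {k} W (B + 1) [] v u s
copyClean {B = B} v u s v≢u v< = record
  { program    = copy (false , v) (false , u) ∷ []
  ; correct    = λ a α β → copy-correct a (false , v) (false , u) (α , β)
  ; length≤    = m≤n+m 1 B
  ; admissible = ((λ { refl → v≢u refl }) , v<) ∷ [] }

leafClean : ∀ {k W} g (i : Fin k) v u s → v ≢ u → v ≢ s → v < W → Clean W 4 ((g , leaf i) ∷ []) v u s
leafClean {k} {W} g i v u s v≢u v≢s v< = record
  { program = program g ; correct = correct g ; length≤ = length≤ g ; admissible = admissible g }
  where
  load-u load-s copy-u : Instr k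
  load-u = (false , v) += (false , u) · just i
  load-s = (false , v) += (false , s) · just i
  copy-u = copy (false , v) (false , u)
  program : Gate → Program k
  program AND = load-u ∷ []
  program XOR = copy-u ∷ load-s ∷ []
  program OR  = copy-u ∷ load-u ∷ load-s ∷ []
  open xor-∧-Solver using (solve; con; _:+_; _:*_; _:=_)
  correct : ∀ g a α β → run a (program g) (α , β) ≈ (put v (act a ((g , leaf i) ∷ []) (α u) (α s)) α , β)
  correct AND a α β = ≈-refl
  correct XOR a α β = (λ r → trans
    (cong (λ z → put v (z ∧ a i) (put v (α u ∧ true) α) r) (put-other (α u ∧ true) α v≢s))
    (solve 5 (λ x u s i d → (x :+ (u :* con true) :* d) :+ (s :* i) :* d := x :+ (u :+ s :* i) :* d)
      refl (α r) (α u) (α s) (a i) (does (v ≟ r)))) , λ _ → refl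
  correct OR a α β = (λ r → trans
    (cong₂ (λ w z → put v (z ∧ a i) (put v (w ∧ a i) α₁) r)
      (put-other (α u ∧ true) α v≢u)
      (trans (put-other (α₁ u ∧ a i) α₁ v≢s) (put-other (α u ∧ true) α v≢s)))
    (solve 5 (λ x u s i d →
        ((x :+ (u :* con true) :* d) :+ (u :* i) :* d) :+ (s :* i) :* d := x :+ (u :+ (u :+ s) :* i) :* d)
      refl (α r) (α u) (α s) (a i) (does (v ≟ r)))) , λ _ → refl
    where α₁ = put v (α u ∧ true) α
  length≤ : ∀ g → length (program g) ≤ 4
  length≤ AND = s≤s z≤n
  length≤ XOR = s≤s (s≤s z≤n)
  length≤ OR  = s≤s (s≤s (s≤s z≤n))
  u-ok : ∀ {g : _} → Admissible W ((false , v) += (false , u) · g)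
  u-ok = (λ { refl → v≢u refl }) , v<
  s-ok : ∀ {g : _} → Admissible W ((false , v) += (false , s) · g)
  s-ok = (λ { refl → v≢s refl }) , v<
  admissible : ∀ g → All (Admissible W) (program g)
  admissible AND = u-ok {just i} ∷ []
  admissible XOR = u-ok {nothing} ∷ s-ok {just i} ∷ []
  admissible OR  = u-ok {nothing} ∷ u-ok {just i} ∷ s-ok {just i} ∷ []

-- The machine p, run on registers 0 and 1 of the other bank, leaves the wanted
-- value in its output register only up to the initial contents of that bank, and
-- leaves garbage elsewhere.  By linearity the commutator of N⁻¹ Z N, where Z
-- loads the inputs, with adding the output register to v cancels both.
module Commutator {k M W A} (clean : CleanUpTo k M W A)
  {L} (L+2≤W : 2 + L ≤ W) (c : Chain k)
  (P : Plan M L 2 (chainLeaves c) (λ a ρ → act a c (ρ 0) (ρ 1))) where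

  private
    module P = Plan P
    module N = Machine (machine {A = A} clean P.code (≤-trans P.top≤ L+2≤W))

  commutator : ∀ v u s → v ≢ u → v ≢ s → v < W →
    Clean W (4 * (A * chainLeaves c + 2 * L) + 6) c v u s
  commutator v u s v≢u v≢s v< = record
    { program = half ++ half ; correct = correct ; length≤ = length≤ ; admissible = ++⁺ half-ok half-ok }
    where
    X Z half : Program k
    X = copy (false , v) (true , P.out) ∷ []
    Z = copy (true , 0) (false , u) ∷ copy (true , 1) (false , s) ∷ []
    half = X ++ N.backward ++ Z ++ N.forward

    half-ok : All (Admissible W) half
    half-ok = ((λ ()) , v<) ∷ ++⁺ N.backward-admissible
      (((λ ()) , ≤-trans (s≤s z≤n) L+2≤W) ∷ ((λ ()) , ≤-trans (s≤s (s≤s z≤n)) L+2≤W) ∷ N.forward-admissible)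

    N-length : ∀ {x} → x + 2 * 2 ≤ A * load P.code + 2 * P.top → x ≤ A * chainLeaves c + 2 * L
    N-length {x} x≤ = +-cancelʳ-≤ 4 x _ (begin
      x + 4                              ≤⟨ x≤ ⟩
      A * load P.code + 2 * P.top        ≤⟨ +-mono-≤ (*-monoʳ-≤ A P.load≤) (*-monoʳ-≤ 2 P.top≤) ⟩
      A * chainLeaves c + 2 * (2 + L)    ≡⟨ solve 2 (λ x L → x :+ con 2 :* (con 2 :+ L)
                                              := x :+ con 2 :* L :+ con 4) refl (A * chainLeaves c) L ⟩
      A * chainLeaves c + 2 * L + 4      ∎)
      where
      open ≤-Reasoning
      open +-*-Solver

    length≤ : length (half ++ half) ≤ 4 * (A * chainLeaves c + 2 * L) + 6
    length≤ = begin
      length (half ++ half) ≡⟨ length-++ half {half} ⟩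
      length half + length half ≡⟨ cong (λ z → suc z + suc z) (length-++ N.backward {Z ++ N.forward}) ⟩
      suc (length N.backward + suc (suc (length N.forward))) +
      suc (length N.backward + suc (suc (length N.forward)))
        ≡⟨ solve 2 (λ x y → let h = con 1 :+ (x :+ (con 2 :+ y)) in
             h :+ h := con 2 :* (x :+ y) :+ con 6) refl (length N.backward) (length N.forward) ⟩
      2 * (length N.backward + length N.forward) + 6
        ≤⟨ +-monoˡ-≤ 6 (*-monoʳ-≤ 2 (+-mono-≤ (N-length N.backward-length) (N-length N.forward-length))) ⟩
      2 * (B + B) + 6 ≡⟨ solve 1 (λ B → con 2 :* (B :+ B) :+ con 6 := con 4 :* B :+ con 6) refl B ⟩
      4 * B + 6 ∎
      where
      open ≤-Reasoning
      open +-*-Solver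
      B = A * chainLeaves c + 2 * L

    module _ (a : Fin k → Bool) (α β : Env) where
      δ β⁻ Nδ : Env
      -- The inputs loaded into an empty bank: the only situation in which the plan is known to be
      -- correct.
      δ  = put 1 (α s) (put 0 (α u) (λ _ → false))
      β⁻ = unexec a P.code β
      Nδ = exec a P.code δ
      y : Bool
      y = act a c (α u) (α s)
      α₁ α₂ : Env
      α₁ = put v (β P.out) α
      α₂ = put v y α
      zero-above : ∀ r → 2 ≤ r → δ r ≡ false
      zero-above (suc (suc r)) _ rewrite ∧-zeroʳ (α u) | ∧-zeroʳ (α s) = refl
      zero-above (suc zero) (s≤s ())
      Nδ-out : Nδ P.out ≡ y
      Nδ-out = trans (P.correct a δ zero-above) (cong₂ (act a c)
        (trans (cong ((α u ∧ true) xor_) (∧-zeroʳ (α s))) (trans (xor-identityʳ _) (∧-identityʳ (α u))))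
        (trans (cong (λ z → z xor (α s ∧ true)) (∧-zeroʳ (α u))) (∧-identityʳ (α s))))
      load-inputs : ∀ x γ → run a Z (put v x α , γ) ≈ (put v x α , γ ⊞ δ)
      load-inputs x γ = (λ _ → refl) , λ r → trans
        (put-cong 1 (trans (∧-identityʳ _) (put-other x α v≢s))
          (put-cong 0 {β = γ} (trans (∧-identityʳ _) (put-other x α v≢u)) (λ _ → refl)) r)
        (xor-assoc (γ r) (α u ∧ _) (α s ∧ _))
      forward-shift : exec a P.code (β⁻ ⊞ δ) ≗ₑ β ⊞ Nδ
      forward-shift i = trans (exec-⊞ a P.code β⁻ δ i) (cong (_xor Nδ i) (exec-unexec a P.code β i))
      backward-shift : unexec a P.code (β ⊞ Nδ) ≗ₑ β⁻ ⊞ δ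
      backward-shift i = trans (unexec-cong a P.code (λ j → sym (forward-shift j)) i)
                               (unexec-exec a P.code (β⁻ ⊞ δ) i)
      -- So far v has received only garbage, the old content of the output register; the wanted
      -- value sits on top of it in the scratch bank.
      first-half : run a half (α , β) ≈ (α₁ , β ⊞ Nδ)
      first-half =
        _▸_ a {X} {N.backward ++ Z ++ N.forward} {α , β} (copy-correct a (false , v) (true , P.out) (α , β))
        (_▸_ a {N.backward} {Z ++ N.forward} (N.backward-correct a α₁ β)
        (_▸_ a {Z} {N.forward} {α₁ , β⁻} (load-inputs (β P.out) β⁻)
        (≈-trans (N.forward-correct a α₁ _) ((λ _ → refl) , forward-shift))))
      -- The garbage reaches v a second time and cancels, leaving y. Loading the inputs again
      -- removes δ, so the last run restores β.
      second-half : run a half (α₁ , β ⊞ Nδ) ≈ (α₂ , β)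
      second-half =
        _▸_ a {X} {N.backward ++ Z ++ N.forward} {α₁ , β ⊞ Nδ}
          (≈-trans (copy-correct a (false , v) (true , P.out) (α₁ , β ⊞ Nδ))
            ((λ r → trans (put-twice v (β P.out) ((β ⊞ Nδ) P.out) α r)
               (cong (λ z → put v z α r) (trans (sym (xor-assoc (β P.out) (β P.out) (Nδ P.out)))
                 (trans (cong (_xor Nδ P.out) (xor-same (β P.out))) Nδ-out)))) , λ _ → refl))
        (_▸_ a {N.backward} {Z ++ N.forward} (≈-trans (N.backward-correct a α₂ _) ((λ _ → refl) , backward-shift))
        (_▸_ a {Z} {N.forward} {α₂ , β⁻ ⊞ δ} (≈-trans (load-inputs y (β⁻ ⊞ δ))
            ((λ _ → refl) , λ r → trans (xor-assoc (β⁻ r) (δ r) (δ r))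
                                 (trans (cong (β⁻ r xor_) (xor-same (δ r))) (xor-identityʳ (β⁻ r)))))
        (≈-trans (N.forward-correct a α₂ β⁻) ((λ _ → refl) , exec-unexec a P.code β))))
      correct : run a (half ++ half) (α , β) ≈ (α₂ , β)
      correct = _▸_ a {half} {half} {α , β} first-half second-half

-- W does not depend on j: the code of a level sits in the other bank, and the calls below it come
-- back to the first one, whose contents they restore. At j = 0 the chain is empty or a single leaf.
cleanProgram : ∀ {k} d W → 2 + codeLength d ≤ W → ∀ j → CleanUpTo k ((2 ^ d) ^ j) W (cost d j)
cleanProgram d W W≥ j [] v u s _ v≢u v≢s v< = copyClean v u s v≢u v<
cleanProgram d W W≥ zero ((g , leaf i) ∷ []) v u s _ v≢u v≢s v< = leafClean g i v u s v≢u v≢s v<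
cleanProgram d W W≥ zero ((g , leaf i) ∷ (g′ , t) ∷ c) v u s (s≤s ≤0) v≢u v≢s v<
  with () ← ≤-trans (≤-trans (leaves-positive t) (m≤m+n _ _)) ≤0
cleanProgram d W W≥ zero ((g , node g′ l r) ∷ c) v u s ≤1 v≢u v≢s v<
  with s≤s () ← ≤-trans (≤-trans (+-mono-≤ (leaves-positive l) (leaves-positive r)) (m≤m+n _ _)) ≤1
cleanProgram d W W≥ (suc j) c@((g , t) ∷ c′) v u s c≤ v≢u v≢s v< = record
  { program = program ; correct = correct ; admissible = admissible
  ; length≤ = ≤-trans length≤ bound }
  where
  open Clean (Commutator.commutator {A = cost d j} (cleanProgram d W W≥ j) W≥ c
                (plan d _ c c≤ (s≤s z≤n) (s≤s (s≤s z≤n))) v u s v≢u v≢s v<)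
  K = cost d j
  ℓ = codeLength d
  x = chainLeaves c
  -- A nonempty chain has a leaf, so the additive overhead can be charged to its leaves.
  bound : 4 * (K * x + 2 * ℓ) + 6 ≤ cost d (suc j) * x + 1
  bound = begin
    4 * (K * x + 2 * ℓ) + 6        ≡⟨ solve 3 (λ K x ℓ → con 4 :* (K :* x :+ con 2 :* ℓ) :+ con 6
                                        := con 4 :* K :* x :+ (con 8 :* ℓ :+ con 6)) refl K x ℓ ⟩
    4 * K * x + levelOverhead d    ≤⟨ +-monoʳ-≤ (4 * K * x) (≤-trans (≤-reflexive (sym (*-identityʳ _)))
                                        (*-monoʳ-≤ (levelOverhead d) (≤-trans (leaves-positive t) (m≤m+n _ _)))) ⟩
    4 * K * x + levelOverhead d * x ≡⟨ sym (*-distribʳ-+ x (4 * K) (levelOverhead d)) ⟩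
    cost d (suc j) * x             ≤⟨ m≤m+n _ 1 ⟩
    cost d (suc j) * x + 1         ∎
    where
    open ≤-Reasoning
    open +-*-Solver

-- Walks in the garden-hose graph

lookup-injective : ∀ {A : Set} {xs : List A} → Unique xs →
  ∀ {i j} → lookup xs i ≡ lookup xs j → i ≡ j
lookup-injective (x∉ ∷ u) {zero}  {zero}  e = refl
lookup-injective (x∉ ∷ u) {zero}  {suc j} e = contradiction e (All.lookup x∉ (∈-lookup j))
lookup-injective (x∉ ∷ u) {suc i} {zero}  e = contradiction (sym e) (All.lookup x∉ (∈-lookup i))
lookup-injective (x∉ ∷ u) {suc i} {suc j} e = cong suc (lookup-injective u e)

unique-length : ∀ {n} {xs : List (Fin n)} → Unique xs → length xs ≤ n
unique-length u = injective⇒≤ (lookup-injective u)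

-- The partial matchings of Alice (side false) and Bob (side true).
Graph : Set → Set
Graph V = Bool → V → Maybe V

-- The side to be followed next alternates, so the two sides of a path record the parity of its
-- length.
data Path {V : Set} (G : Graph V) : Bool → V → Bool → V → Set where
  []  : ∀ {S v} → Path G S v S v
  _∷_ : ∀ {S v w T z} → G S v ≡ just w → Path G (not S) w T z → Path G S v T z

_◅◅_ : ∀ {V : Set} {G : Graph V} {S v T w U z} → Path G S v T w → Path G T w U z → Path G S v U z
[]      ◅◅ q = q
(e ∷ p) ◅◅ q = e ∷ (p ◅◅ q)

module Walks {s : ℕ} (G : Graph (Fin (suc s))) (matching : ∀ S → IsMatching (G S))
             (tap : G true zero ≡ nothing) where

  -- The walk from the tap which has visited vs, is at v, and next follows side S.
  data Visited : Bool → Fin (suc s) → List (Fin (suc s)) → Set where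
    start : Visited false zero (zero ∷ [])
    visit  : ∀ {S v w vs} → Visited S v vs → G S v ≡ just w → Visited (not S) w (w ∷ vs)

  current∈ : ∀ {S v vs} → Visited S v vs → v ∈ vs
  current∈ start      = here refl
  current∈ (visit _ _) = here refl

  zero∈ : ∀ {S v vs} → Visited S v vs → zero ∈ vs
  zero∈ start      = here refl
  zero∈ (visit h _) = there (zero∈ h)

  -- An inner vertex of the walk is entered by one matching and left by the other, and the tap has
  -- no edge of Bob. Only the edge to be followed next can lead out.
  closed : ∀ {S v vs} → Visited S v vs → ∀ T {u w} → u ∈ vs → G T u ≡ just w →
    w ∈ vs ⊎ (u ≡ v × T ≡ S)
  closed start false (here refl) e = inj₂ (refl , refl)
  closed start true  (here refl) e = contradiction (trans (sym tap) e) λ ()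
  closed (visit {false} h e′) true  (here refl) e = inj₂ (refl , refl)
  closed (visit {true}  h e′) false (here refl) e = inj₂ (refl , refl)
  closed (visit {false} h e′) false (here refl) e
    with refl ← trans (sym e) (proj₁ (matching false _ _ e′)) = inj₁ (there (current∈ h))
  closed (visit {true}  h e′) true  (here refl) e
    with refl ← trans (sym e) (proj₁ (matching true _ _ e′)) = inj₁ (there (current∈ h))
  closed (visit h e′) T (there u∈) e with closed h T u∈ e
  ... | inj₁ w∈            = inj₁ (there w∈)
  ... | inj₂ (refl , refl) = inj₁ (here (just-injective (trans (sym e) e′)))

  -- By `closed`, a return to w would put v, the other end of the edge, among the vertices visited
  -- before it: an earlier return.
  next∉ : ∀ {S v w vs} → Visited S v vs → G S v ≡ just w → w ∉ vs
  next∉ start e (here refl) = proj₂ (matching _ _ _ e) refl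
  next∉ (visit h e′) e (here refl) = proj₂ (matching _ _ _ e) refl
  next∉ (visit {S} h e′) e (there w∈) with closed h (not S) w∈ (proj₁ (matching _ _ _ e))
  ... | inj₁ v∈ = next∉ h e′ v∈
  next∉ (visit {false} h e′) e (there w∈) | inj₂ (_ , ())
  next∉ (visit {true}  h e′) e (there w∈) | inj₂ (_ , ())

  visited-unique : ∀ {S v vs} → Visited S v vs → Unique vs
  visited-unique start      = [] ∷ []
  visited-unique (visit h e) = ¬Any⇒All¬ _ (next∉ h e) ∷ visited-unique h

  -- `off-tap` is for networks, where Bob joins taps of copies to other gadgets: a dead end on his
  -- side must be a pipe.
  record Maximal (S : Bool) (v : Fin (suc s)) : Set where
    field
      side  : Bool
      end   : Fin (suc s)
      path  : Path G S v side end
      stuck : G side end ≡ nothing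
      off-tap : side ≡ true → end ≢ zero

  stay-off-tap : ∀ {S v vs} → Visited S v vs → S ≡ true → v ≢ zero
  stay-off-tap (visit h e) _ refl = next∉ h e (zero∈ h)

  -- The next vertex is always new, so the comparison with `prev` never stops the walk, and by the
  -- pigeonhole principle the fuel outlasts it.
  walk-maximal : ∀ n {S v prev vs} → Visited S v vs → prev ∈ vs → suc s < length vs + n →
    Σ (Maximal S v) λ m → walk n (G S) (G (not S)) prev v ≡ S xor Maximal.side m
  walk-maximal zero h _ s< = contradiction (unique-length (visited-unique h))
    (<⇒≱ (<-≤-trans s< (≤-reflexive (+-identityʳ _))))
  walk-maximal (suc n) {S} {v} {prev} {vs} h prev∈ s< with G S v in e
  ... | nothing = record { side = S ; end = v ; path = [] ; stuck = e ; off-tap = stay-off-tap h }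
                , sym (xor-same S)
  ... | just w with w Fin.≟ prev
  ...   | yes refl = contradiction prev∈ (next∉ h e)
  ...   | no _ with walk-maximal n (visit h e) (there (current∈ h)) (<-≤-trans s< (≤-reflexive (+-suc _ n)))
  ...     | m , eq = record { side = side ; end = end ; path = e ∷ path ; stuck = stuck ; off-tap = off-tap }
                   , (begin
    not (walk n (G (not S)) (G S) v w)
      ≡⟨ cong (λ T → not (walk n (G (not S)) (G T) v w)) (sym (not-involutive S)) ⟩
    not (walk n (G (not S)) (G (not (not S))) v w)
      ≡⟨ cong not eq ⟩
    not (not S xor side)
      ≡⟨ not-distribˡ-xor (not S) side ⟩
    not (not S) xor side
      ≡⟨ cong (_xor side) (not-involutive S) ⟩
    S xor side ∎)
    where
    open Maximal m
    open ≡-Reasoning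

  parity-maximal : Σ (Maximal false zero) λ m → pathParity (G false) (G true) ≡ Maximal.side m
  parity-maximal with G false zero in e
  ... | nothing = record { side = false ; end = zero ; path = [] ; stuck = e ; off-tap = λ () } , refl
  ... | just w with walk-maximal (suc s) (visit start e) (there (here refl)) (s≤s (s≤s (n≤1+n _)))
  ...   | m , eq = record { side = side ; end = end ; path = e ∷ path ; stuck = stuck ; off-tap = off-tap }
                 , trans (cong not eq) (not-involutive side)
    where open Maximal m

  path-deterministic : ∀ {S v T w T′ w′} → Path G S v T w → G T w ≡ nothing →
    Path G S v T′ w′ → G T′ w′ ≡ nothing → T ≡ T′
  path-deterministic []      _ []      _  = refl
  path-deterministic []      n (e ∷ _) _  = contradiction (trans (sym n) e) λ ()
  path-deterministic (e ∷ _) _ []      n  = contradiction (trans (sym n) e) λ ()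
  path-deterministic (e ∷ p) n (e′ ∷ p′) n′ with refl ← trans (sym e) e′ = path-deterministic p n p′ n′

  -- Exhibiting one path to a dead end thus settles the output, with no reasoning about fuel.
  parity-of-path : ∀ {T w} → Path G false zero T w → G T w ≡ nothing →
    pathParity (G false) (G true) ≡ T
  parity-of-path p n with parity-maximal
  ... | m , eq = trans eq (path-deterministic path stuck p n)
    where open Maximal m

-- Networks of protocols

Matching : ∀ {V : Set} → (V → Maybe V) → Set
Matching {V} μ = ∀ (u v : V) → μ u ≡ just v → (μ v ≡ just u) × (u ≢ v)

map-just : ∀ {A B : Set} {f : A → B} m {y} → map f m ≡ just y → ∃ λ x → m ≡ just x × f x ≡ y
map-just (just x) refl = x , refl , refl

-- Copies of a protocol are named nothing (the main copy) and just S; the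
-- dead ends of the main copy on side S are joined to those of copy just S,
-- so that a path stuck on side S returns through that copy to its tap.
Copy : Set
Copy = Maybe Bool

cross : Bool → Copy → Maybe Copy
cross S     nothing      = just (just S)
cross false (just false) = just nothing
cross true  (just true)  = just nothing
cross false (just true)  = nothing
cross true  (just false) = nothing

cross-matching : ∀ S → Matching (cross S)
cross-matching false nothing      _ refl = refl , λ ()
cross-matching true  nothing      _ refl = refl , λ ()
cross-matching false (just false) _ refl = refl , λ ()
cross-matching true  (just true)  _ refl = refl , λ ()

double : ∀ {n} → Bool → (Fin n → Maybe (Fin n)) → Copy × Fin n → Maybe (Copy × Fin n)
double S μ (κ , a) with μ a
... | just b  = just (κ , b)
... | nothing = map (_, a) (cross S κ)

double-just : ∀ {n} S (μ : Fin n → Maybe (Fin n)) κ {a b} → μ a ≡ just b →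
  double S μ (κ , a) ≡ just (κ , b)
double-just S μ κ e rewrite e = refl

double-nothing : ∀ {n} S (μ : Fin n → Maybe (Fin n)) {κ κ′ a} → μ a ≡ nothing → cross S κ ≡ just κ′ →
  double S μ (κ , a) ≡ just (κ′ , a)
double-nothing S μ e f rewrite e | f = refl

double-matching : ∀ {n} S {μ : Fin n → Maybe (Fin n)} → Matching μ → Matching (double S μ)
double-matching S {μ} m (κ , a) v e with μ a in eq
double-matching S {μ} m (κ , a) v refl | just b =
  double-just S μ κ (proj₁ (m a b eq)) , λ { refl → proj₂ (m a b eq) refl }
double-matching S {μ} m (κ , a) v e | nothing with map-just (cross S κ) e
... | κ′ , f , refl = double-nothing S μ eq (proj₁ (cross-matching S κ κ′ f))
                    , λ { refl → proj₂ (cross-matching S κ κ′ f) refl }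

union : ∀ {V : Set} → (V → Maybe V) → (V → Maybe V) → Graph V
union μ ν false = μ
union μ ν true  = ν

liftB-matching : ∀ {n} {μ : Fin n → Maybe (Fin n)} → IsMatching μ → IsMatching (liftB μ)
liftB-matching {μ = μ} m (suc u) v e with μ u in eq
liftB-matching {μ = μ} m (suc u) v refl | just w rewrite proj₁ (m u w eq) =
  refl , λ { refl → proj₂ (m u w eq) refl }

-- A state and its image are joined by an edge of Bob, which must read the same from both ends;
-- hence `involutive`.
record Layer (X Y State : Set) (c : ℕ) : Set where
  field
    {pipes}    : ℕ
    pipes≤     : pipes ≤ c
    protocol   : GHProtocol X Y pipes
    permute    : Bool → State → State
    involutive : ∀ b σ → permute b (permute b σ) ≡ σ

module Network {X Y State : Set} {c : ℕ} (accepts : State → Bool) where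
  open Layer
  open GHProtocol

  Layers : Set
  Layers = List (Layer X Y State c)

  runLayers : Layers → X → Y → State → State
  runLayers []       x y σ = σ
  runLayers (ℓ ∷ ls) x y σ = runLayers ls x y (permute ℓ (output (protocol ℓ) x y) σ)

  -- Every layer has, for every state, a forward gadget (false), which routes
  -- the path to copy just b of the tap when the protocol outputs b, and a
  -- backward gadget (true), which leads from there back to the main tap.
  Vertex : Layers → Set
  Vertex []       = State × Bool
  Vertex (ℓ ∷ ls) = (Bool × State × Copy × Fin (suc (pipes ℓ))) ⊎ Vertex ls

  port : ∀ ls → State → Vertex ls
  port []       σ = σ , false
  port (ℓ ∷ ls) σ = inj₁ (false , σ , nothing , zero)

  port? : ∀ ls → Vertex ls → Maybe State
  port? []       (σ , false)                          = just σ
  port? []       (σ , true)                           = nothing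
  port? (ℓ ∷ ls) (inj₁ (false , σ , nothing , zero))  = just σ
  port? (ℓ ∷ ls) (inj₁ (false , σ , nothing , suc a)) = nothing
  port? (ℓ ∷ ls) (inj₁ (false , σ , just e , a))      = nothing
  port? (ℓ ∷ ls) (inj₁ (true , σ , κ , a))            = nothing
  port? (ℓ ∷ ls) (inj₂ v)                             = nothing

  port?-port : ∀ ls σ → port? ls (port ls σ) ≡ just σ
  port?-port []       σ = refl
  port?-port (ℓ ∷ ls) σ = refl

  port?-just : ∀ ls v {σ} → port? ls v ≡ just σ → v ≡ port ls σ
  port?-just []       (σ , false)                         refl = refl
  port?-just (ℓ ∷ ls) (inj₁ (false , σ , nothing , zero)) refl = refl

  -- After the last layer an accepting state gets one more edge, which flips the parity.
  alice : ∀ ls → X → Vertex ls → Maybe (Vertex ls)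
  alice []       x (σ , b)            = if accepts σ then just (σ , not b) else nothing
  alice (ℓ ∷ ls) x (inj₁ (d , σ , z)) = map (λ z → inj₁ (d , σ , z)) (double false (EA (protocol ℓ) x) z)
  alice (ℓ ∷ ls) x (inj₂ v)           = map inj₂ (alice ls x v)

  inner : ∀ {n} {Rest : Set} → Bool → State → Copy × Fin n →
    (Bool × State × Copy × Fin (suc n)) ⊎ Rest
  inner d σ (κ , a) = inj₁ (d , σ , κ , suc a)

  -- Taps are free on Bob's side, so all connections between gadgets are his: between the taps of
  -- the copies `just e` in the two directions, and from a backward main tap to the next port. The
  -- port of the first layer stays free, as the tap of the network.
  bob : ∀ ls → Y → Vertex ls → Maybe (Vertex ls)
  bob []       y v = nothing
  bob (ℓ ∷ ls) y (inj₁ (d , σ , κ , suc a)) = map (inner d σ) (double true (EB (protocol ℓ) y) (κ , a))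
  bob (ℓ ∷ ls) y (inj₁ (d , σ , just e , zero))       = just (inj₁ (not d , permute ℓ e σ , just e , zero))
  bob (ℓ ∷ ls) y (inj₁ (true , σ , nothing , zero))   = just (inj₂ (port ls σ))
  bob (ℓ ∷ ls) y (inj₁ (false , σ , nothing , zero))  = nothing
  bob (ℓ ∷ ls) y (inj₂ v) with port? ls v
  ... | just σ  = just (inj₁ (true , σ , nothing , zero))
  ... | nothing = map inj₂ (bob ls y v)

  bob-port : ∀ ls y σ → bob ls y (port ls σ) ≡ nothing
  bob-port []       y σ = refl
  bob-port (ℓ ∷ ls) y σ = refl

  bob-next : ∀ ℓ ls y {v w} → bob ls y v ≡ just w → bob (ℓ ∷ ls) y (inj₂ v) ≡ just (inj₂ w)
  bob-next ℓ ls y {v} e with port? ls v in eq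
  ... | nothing = cong (map inj₂) e
  ... | just σ  with refl ← port?-just ls v eq = contradiction (trans (sym (bob-port ls y σ)) e) λ ()

  alice-matching : ∀ ls x → Matching (alice ls x)
  alice-matching [] x (σ , b) v e with accepts σ in eq
  alice-matching [] x (σ , false) v refl | true rewrite eq = refl , λ ()
  alice-matching [] x (σ , true)  v refl | true rewrite eq = refl , λ ()
  alice-matching (ℓ ∷ ls) x (inj₁ (d , σ , z)) v e with map-just (double false (EA (protocol ℓ) x) z) e
  ... | z′ , f , refl with double-matching false (EA-matching (protocol ℓ) x) z z′ f
  ...   | g , z≢ = cong (map _) g , λ { refl → z≢ refl }
  alice-matching (ℓ ∷ ls) x (inj₂ u) v e with map-just (alice ls x u) e
  ... | w , f , refl with alice-matching ls x u w f
  ...   | g , u≢ = cong (map inj₂) g , λ { refl → u≢ refl }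

  bob-matching : ∀ ls y → Matching (bob ls y)
  bob-matching (ℓ ∷ ls) y (inj₁ (d , σ , κ , suc a)) v e with map-just (double true (EB (protocol ℓ) y) (κ , a)) e
  ... | z′ , f , refl with double-matching true (EB-matching (protocol ℓ) y) (κ , a) z′ f
  ...   | g , z≢ = cong (map (inner d σ)) g , λ { refl → z≢ refl }
  bob-matching (ℓ ∷ ls) y (inj₁ (false , σ , just e , zero)) v refl =
    cong (λ τ → just (inj₁ (false , τ , just e , zero))) (involutive ℓ e σ) , λ ()
  bob-matching (ℓ ∷ ls) y (inj₁ (true , σ , just e , zero)) v refl =
    cong (λ τ → just (inj₁ (true , τ , just e , zero))) (involutive ℓ e σ) , λ ()
  bob-matching (ℓ ∷ ls) y (inj₁ (true , σ , nothing , zero)) v refl rewrite port?-port ls σ = refl , λ ()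
  bob-matching (ℓ ∷ ls) y (inj₂ u) v e with port? ls u in eq
  bob-matching (ℓ ∷ ls) y (inj₂ u) v refl | just σ = cong (λ w → just (inj₂ w)) (sym (port?-just ls u eq)) , λ ()
  bob-matching (ℓ ∷ ls) y (inj₂ u) v e | nothing with map-just (bob ls y u) e
  ... | w , f , refl with bob-matching ls y u w f
  ...   | g , u≢ = bob-next ℓ ls y g , λ { refl → u≢ refl }

  graph : ∀ ls → X → Y → Graph (Vertex ls)
  graph ls x y = union (alice ls x) (bob ls y)

  protocolGraph : ∀ {s} → GHProtocol X Y s → X → Y → Graph (Fin (suc s))
  protocolGraph P x y = union (EA P x) (liftB (EB P y))

  protocolGraph-matching : ∀ {s} (P : GHProtocol X Y s) x y S → IsMatching (protocolGraph P x y S)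
  protocolGraph-matching P x y false = EA-matching P x
  protocolGraph-matching P x y true  = liftB-matching (EB-matching P y)

  module Gadget (ℓ : Layer X Y State c) (ls : Layers) (x : X) (y : Y) where
    private
      P = protocol ℓ
      g = protocolGraph P x y
      G = graph (ℓ ∷ ls) x y

    at : Bool → State → Copy → Fin (suc (pipes ℓ)) → Vertex (ℓ ∷ ls)
    at d σ κ a = inj₁ (d , σ , κ , a)

    follow : ∀ S {d σ κ a b} → g S a ≡ just b → G S (at d σ κ a) ≡ just (at d σ κ b)
    follow false e = cong (map _) (double-just false (EA P x) _ e)
    follow true {a = suc a} e with EB P y a in eq
    follow true {a = suc a} refl | just b = refl

    turn : ∀ S {d σ κ κ′ a} → cross S κ ≡ just κ′ → g S a ≡ nothing → (S ≡ true → a ≢ zero) →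
      G S (at d σ κ a) ≡ just (at d σ κ′ a)
    turn false f e _ = cong (map _) (double-nothing false (EA P x) e f)
    turn true {a = zero}  f e off = contradiction refl (off refl)
    turn true {a = suc a} f e off with EB P y a
    turn true {a = suc a} f e off | nothing rewrite f = refl

    -- The dead end of one copy is joined to that of the other, along which the same edges lead
    -- back. An end depending on both inputs is thus replaced by a known vertex.
    retrace : ∀ {S a T z d σ κ κ′} → Path g S a T z → g T z ≡ nothing → (T ≡ true → z ≢ zero) →
      cross T κ ≡ just κ′ → Path G S (at d σ κ a) (not S) (at d σ κ′ a)
    retrace {S} [] n off f = turn S f n off ∷ []
    retrace {false} (e ∷ p) n off f = follow false e ∷ (retrace p n off f
      ◅◅ (follow false (proj₁ (protocolGraph-matching P x y false _ _ e)) ∷ []))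
    retrace {true} {a} (_∷_ {w = b} e p) n off f = follow true {a = a} e ∷ (retrace p n off f
      ◅◅ (follow true {a = b} (proj₁ (protocolGraph-matching P x y true a b e)) ∷ []))

    -- The side of the dead end is the output, so it selects the copy of the tap reached and thereby
    -- the permutation. The backward gadget has the same dead end and merges the two possible
    -- arrivals at its main tap, again on Alice's side.
    traverse : ∀ σ → Path G false (port (ℓ ∷ ls) σ) false (inj₂ (port ls (permute ℓ (output P x y) σ)))
    traverse σ with Walks.parity-maximal g (protocolGraph-matching P x y) refl
    ... | m , eq rewrite eq =
      retrace path stuck off-tap refl ◅◅ (refl ∷ (retrace path stuck off-tap (cross-back side) ◅◅ (refl ∷ [])))
      where
      open Walks.Maximal m
      cross-back : ∀ e → cross e (just e) ≡ just nothing
      cross-back false = refl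
      cross-back true  = refl

  next-path : ∀ ℓ ls x y {S v T w} → Path (graph ls x y) S v T w →
    Path (graph (ℓ ∷ ls) x y) S (inj₂ v) T (inj₂ w)
  next-path ℓ ls x y []              = []
  next-path ℓ ls x y {false} (e ∷ p) = cong (map inj₂) e ∷ next-path ℓ ls x y p
  next-path ℓ ls x y {true}  (e ∷ p) = bob-next ℓ ls y e ∷ next-path ℓ ls x y p

  -- Ports acquire an edge of Bob when a layer is put in front; `inside` keeps a dead end on his
  -- side dead.
  record Accepted (ls : Layers) (x : X) (y : Y) (σ : State) (b : Bool) : Set where
    field
      end   : Vertex ls
      path  : Path (graph ls x y) false (port ls σ) b end
      stuck : graph ls x y b end ≡ nothing
      inside : b ≡ true → port? ls end ≡ nothing

  network-path : ∀ ls x y σ → Accepted ls x y σ (accepts (runLayers ls x y σ))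
  network-path [] x y σ with accepts σ in eq
  ... | true  = record { end = σ , true ; path = alice-accepts ∷ [] ; stuck = refl ; inside = λ _ → refl }
    where
    alice-accepts : alice [] x (σ , false) ≡ just (σ , true)
    alice-accepts rewrite eq = refl
  ... | false = record { end = σ , false ; path = [] ; stuck = alice-rejects ; inside = λ () }
    where
    alice-rejects : alice [] x (σ , false) ≡ nothing
    alice-rejects rewrite eq = refl
  network-path (ℓ ∷ ls) x y σ = record
    { end = inj₂ end ; path = Gadget.traverse ℓ ls x y σ ◅◅ next-path ℓ ls x y path
    ; stuck = still-stuck _ stuck inside ; inside = λ _ → refl }
    where
    open Accepted (network-path ls x y (permute ℓ (output (protocol ℓ) x y) σ))
    still-stuck : ∀ b {v} → graph ls x y b v ≡ nothing → (b ≡ true → port? ls v ≡ nothing) →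
      graph (ℓ ∷ ls) x y b (inj₂ v) ≡ nothing
    still-stuck false n _ = cong (map inj₂) n
    still-stuck true  n i rewrite i refl | n = refl

  vertices : ℕ → Layers → ℕ
  vertices q []       = q * 2
  vertices q (ℓ ∷ ls) = 2 * (q * (3 * suc (pipes ℓ))) + vertices q ls

  3↔Copy : Fin 3 ↔ Copy
  3↔Copy = mk↔ₛ′ (λ { zero → nothing ; (suc zero) → just false ; (suc (suc zero)) → just true })
                 (λ { nothing → zero ; (just false) → suc zero ; (just true) → suc (suc zero) })
                 (λ { nothing → refl ; (just false) → refl ; (just true) → refl })
                 (λ { zero → refl ; (suc zero) → refl ; (suc (suc zero)) → refl })

  enumerate : ∀ {q} → Fin q ↔ State → ∀ ls → Fin (vertices q ls) ↔ Vertex ls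
  enumerate q []       = (q ×-↔ 2↔Bool) ↔-∘ *↔×
  enumerate q (ℓ ∷ ls) = (gadgets ⊎-↔ enumerate q ls) ↔-∘ +↔⊎
    where
    gadgets = (2↔Bool ×-↔ ((q ×-↔ ((3↔Copy ×-↔ ↔-id _) ↔-∘ *↔×)) ↔-∘ *↔×)) ↔-∘ *↔×

-- Numbering the vertices of a network

map-bijection : ∀ {V W : Set} (I : V ↔ W) {μ : W → Maybe W} → Matching μ →
  Matching (λ v → map (Inverse.from I) (μ (Inverse.to I v)))
map-bijection I {μ} m u v e with map-just (μ (Inverse.to I u)) e
... | w , f , refl with m _ _ f
...   | g , u≢ = trans (cong (λ z → map (Inverse.from I) (μ z)) (Inverse.strictlyInverseˡ I w))
                       (trans (cong (map (Inverse.from I)) g) (cong just (Inverse.strictlyInverseʳ I u)))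
               , λ u≡ → u≢ (trans (cong (Inverse.to I) u≡) (Inverse.strictlyInverseˡ I w))

lower : ∀ {m} → Maybe (Fin (suc m)) → Maybe (Fin m)
lower (just (suc i)) = just i
lower (just zero)    = nothing
lower nothing        = nothing

module _ {m : ℕ} (β : Fin (suc m) → Maybe (Fin (suc m))) (matching : Matching β) (tap : β zero ≡ nothing) where

  pipesOf : Fin m → Maybe (Fin m)
  pipesOf i = lower (β (suc i))

  private
    lower-just : ∀ {x : Maybe (Fin (suc m))} {j} → lower x ≡ just j → x ≡ just (suc j)
    lower-just {just (suc i)} refl = refl

  pipesOf-matching : IsMatching pipesOf
  pipesOf-matching u v e with matching (suc u) (suc v) (lower-just e)
  ... | f , u≢ = cong lower f , λ u≡ → u≢ (cong suc u≡)

  liftB-pipesOf : ∀ i → liftB pipesOf i ≡ β i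
  liftB-pipesOf zero = sym tap
  liftB-pipesOf (suc i) with β (suc i) in e
  ... | nothing      = refl
  ... | just (suc j) = refl
  ... | just zero    = contradiction (trans (sym tap) (proj₁ (matching _ _ e))) λ ()

module Realise {X Y V : Set} (A : X → V → Maybe V) (B : Y → V → Maybe V)
  (A-matching : ∀ x → Matching (A x)) (B-matching : ∀ y → Matching (B y))
  (tap : V) (B-tap : ∀ y → B y tap ≡ nothing) (h : X → Y → Bool) where

  module _ (paths : ∀ x y → ∃ λ v →
              Path (union (A x) (B y)) false tap (h x y) v × union (A x) (B y) (h x y) v ≡ nothing) where

    private
      tap-first : ∀ {m} (I : Fin (suc m) ↔ V) → Inverse.to I zero ≡ tap → GH≤ h m
      tap-first {m} I zero≡ = m , ≤-refl , P , computes
        where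
        open Inverse I
        β : Y → Fin (suc m) → Maybe (Fin (suc m))
        β y i = map from (B y (to i))
        β-matching : ∀ y → Matching (β y)
        β-matching y = map-bijection I (B-matching y)
        β-tap : ∀ y → β y zero ≡ nothing
        β-tap y rewrite zero≡ = cong (map from) (B-tap y)
        P : GHProtocol X Y m
        P = record
          { EA = λ x i → map from (A x (to i)) ; EB = λ y → pipesOf (β y) (β-matching y) (β-tap y)
          ; EA-matching = λ x → map-bijection I (A-matching x)
          ; EB-matching = λ y → pipesOf-matching (β y) (β-matching y) (β-tap y) }
        module _ (x : X) (y : Y) where
          G : Graph (Fin (suc m))
          G = union (GHProtocol.EA P x) (liftB (GHProtocol.EB P y))
          G-matching : ∀ S → IsMatching (G S)
          G-matching false = GHProtocol.EA-matching P x
          G-matching true  = liftB-matching (GHProtocol.EB-matching P y)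
          edge : ∀ S v → G S (from v) ≡ map from (union (A x) (B y) S v)
          edge false v = cong (λ z → map from (A x z)) (strictlyInverseˡ v)
          edge true  v = trans (liftB-pipesOf (β y) (β-matching y) (β-tap y) (from v))
                               (cong (λ z → map from (B y z)) (strictlyInverseˡ v))
          encode : ∀ {S v T w} → Path (union (A x) (B y)) S v T w → Path G S (from v) T (from w)
          encode []              = []
          encode {S} {v} (e ∷ p) = trans (edge S v) (cong (map from) e) ∷ encode p
        computes : Computes P h
        computes x y with paths x y
        ... | v , p , stuck = Walks.parity-of-path (G x y) (G-matching x y) refl
          (subst (λ z → Path (G x y) false z (h x y) (from v))
                 (trans (cong from (sym zero≡)) (strictlyInverseʳ zero)) (encode x y p))
          (trans (edge x y (h x y) v) (cong (map from) stuck))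

    realise : ∀ {N b} → N ≤ suc b → Fin N ↔ V → GH≤ h b
    realise {zero}  _ I with () ← Inverse.from I tap
    -- A transposition gives the tap the number zero.
    realise {suc m} (s≤s m≤b) I with tap-first (I ↔-∘ transpose zero (Inverse.from I tap))
                                       (Inverse.strictlyInverseˡ I tap)
    ... | s , s≤m , P = s , ≤-trans s≤m m≤b , P

module _ {X Y State : Set} {c : ℕ} (accepts : State → Bool) where
  open Network {X} {Y} {State} {c} accepts

  network : ∀ {q b} → Fin q ↔ State → ∀ (ls : Layers) σ → vertices q ls ≤ suc b →
    GH≤ (λ x y → accepts (runLayers ls x y σ)) b
  network states ls σ ≤b = Realise.realise (alice ls) (bob ls) (alice-matching ls) (bob-matching ls)
    (port ls σ) (λ y → bob-port ls y σ) _ paths ≤b (enumerate states ls)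
    where
    paths : ∀ x y → ∃ λ v → Path (graph ls x y) false (port ls σ) (accepts (runLayers ls x y σ)) v
                          × graph ls x y (accepts (runLayers ls x y σ)) v ≡ nothing
    paths x y = end , path , stuck
      where open Accepted (network-path ls x y σ)

-- From register programs to protocols

bit : ∀ {W} → Vec Bool W → Env
bit []      i       = false
bit (x ∷ σ) zero    = x
bit (x ∷ σ) (suc i) = bit σ i

xorAt : ∀ {W} → ℕ → Bool → Vec Bool W → Vec Bool W
xorAt i       x []      = []
xorAt zero    x (y ∷ σ) = (y xor x) ∷ σ
xorAt (suc i) x (y ∷ σ) = y ∷ xorAt i x σ

bit-replicate : ∀ W → bit (replicate W false) ≗ₑ λ _ → false
bit-replicate zero    i       = refl
bit-replicate (suc W) zero    = refl
bit-replicate (suc W) (suc i) = bit-replicate W i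

bit-xorAt : ∀ {W i} x (σ : Vec Bool W) → i < W → bit (xorAt i x σ) ≗ₑ put i x (bit σ)
bit-xorAt {i = zero}  x (y ∷ σ) _        zero    = cong (y xor_) (sym (∧-identityʳ x))
bit-xorAt {i = zero}  x (y ∷ σ) _        (suc j) = sym (put-other {0} {suc j} x (bit (y ∷ σ)) λ ())
bit-xorAt {i = suc i} x (y ∷ σ) _        zero    = sym (put-other {suc i} {0} x (bit (y ∷ σ)) λ ())
bit-xorAt {i = suc i} x (y ∷ σ) (s≤s i<) (suc j) = bit-xorAt x σ i< j

bit-xorAt-other : ∀ {W} i j x (σ : Vec Bool W) → i ≢ j → bit (xorAt i x σ) j ≡ bit σ j
bit-xorAt-other i       j       x []      i≢j = refl
bit-xorAt-other zero    zero    x (y ∷ σ) i≢j = contradiction refl i≢j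
bit-xorAt-other zero    (suc j) x (y ∷ σ) i≢j = refl
bit-xorAt-other (suc i) zero    x (y ∷ σ) i≢j = refl
bit-xorAt-other (suc i) (suc j) x (y ∷ σ) i≢j = bit-xorAt-other i j x σ (i≢j ∘ cong suc)

xorAt-cancel : ∀ {W} i x (σ : Vec Bool W) → xorAt i x (xorAt i x σ) ≡ σ
xorAt-cancel i       x []      = refl
xorAt-cancel zero    x (y ∷ σ) =
  cong (_∷ σ) (trans (xor-assoc y x x) (trans (cong (y xor_) (xor-same x)) (xor-identityʳ y)))
xorAt-cancel (suc i) x (y ∷ σ) = cong (y ∷_) (xorAt-cancel i x σ)

-- Vectors instead of `Env`: the gadgets are indexed by a finite set, and `involutive` asks for
-- genuine equality.
State : ℕ → Set
State W = Vec Bool W × Vec Bool W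

bits : ∀ {W} → State W → Store
bits (σ , τ) = bit σ , bit τ

addBit : ∀ {W} → Reg → Bool → State W → State W
addBit (false , i) x (σ , τ) = xorAt i x σ , τ
addBit (true  , i) x (σ , τ) = σ , xorAt i x τ

bits-addBit : ∀ {W} t x (σ : State W) → proj₂ t < W → bits (addBit t x σ) ≈ add t x (bits σ)
bits-addBit (false , i) x (σ , τ) i< = bit-xorAt x σ i< , λ _ → refl
bits-addBit (true  , i) x (σ , τ) i< = (λ _ → refl) , bit-xorAt x τ i<

get-addBit : ∀ {W} t r x (σ : State W) → t ≢ r → get r (bits (addBit t x σ)) ≡ get r (bits σ)
get-addBit (false , i) (false , j) x (σ , τ) t≢r = bit-xorAt-other i j x σ (t≢r ∘ cong (false ,_))
get-addBit (false , i) (true  , j) x (σ , τ) t≢r = refl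
get-addBit (true  , i) (false , j) x (σ , τ) t≢r = refl
get-addBit (true  , i) (true  , j) x (σ , τ) t≢r = bit-xorAt-other i j x τ (t≢r ∘ cong (true ,_))

addBit-cancel : ∀ {W} t x (σ : State W) → addBit t x (addBit t x σ) ≡ σ
addBit-cancel (false , i) x (σ , τ) = cong (_, τ) (xorAt-cancel i x σ)
addBit-cancel (true  , i) x (σ , τ) = cong (σ ,_) (xorAt-cancel i x τ)

Fin↔Vec : ∀ W → Fin (2 ^ W) ↔ Vec Bool W
Fin↔Vec zero    = mk↔ₛ′ (λ _ → []) (λ _ → zero) (λ { [] → refl }) (λ { zero → refl })
Fin↔Vec (suc W) = mk↔ₛ′ (λ { (x , σ) → x ∷ σ }) (λ { (x ∷ σ) → x , σ }) (λ { (x ∷ σ) → refl }) (λ { (x , σ) → refl })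
  ↔-∘ ((2↔Bool ×-↔ Fin↔Vec W) ↔-∘ *↔×)

states : ℕ → ℕ
states W = 2 ^ W * 2 ^ W

Fin↔State : ∀ W → Fin (states W) ↔ State W
Fin↔State W = (Fin↔Vec W ×-↔ Fin↔Vec W) ↔-∘ *↔×

-- Its output is always false. It carries the unguarded instructions, whose permutation ignores the
-- output, and settles c = 0.
idleProtocol : ∀ {X Y} → GHProtocol X Y 0
idleProtocol = record { EA = λ _ _ → nothing ; EB = λ _ () ; EA-matching = λ _ _ _ () ; EB-matching = λ _ () }

GH≤-cong : ∀ {X Y : Set} {h h′ : X → Y → Bool} {b} → (∀ x y → h x y ≡ h′ x y) → GH≤ h b → GH≤ h′ b
GH≤-cong e (s , s≤ , P , computes) = s , s≤ , P , λ x y → trans (computes x y) (e x y)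

-- With the tap as the only vertex, an edge would be a loop.
GH≤0-false : ∀ {X Y : Set} {h : X → Y → Bool} → GH≤ h 0 → ∀ x y → h x y ≡ false
GH≤0-false (zero , _ , P , computes) x y with GHProtocol.EA P x zero in e | computes x y
... | nothing   | eq = sym eq
... | just zero | _  = contradiction refl (proj₂ (GHProtocol.EA-matching P x zero zero e))

module Simulation {X Y : Set} {k c : ℕ} (W : ℕ) (f : Fin k → X → Y → Bool) (f≤ : ∀ i → GH≤ (f i) c) where

  accepts : State W → Bool
  accepts (σ , τ) = bit σ 0

  open Network {X} {Y} {State W} {c} accepts

  layer : (i : Instr k) → Admissible W i → Layer X Y (State W) c
  layer (t += r · nothing) (t≢r , t<) = record
    { pipes≤ = z≤n ; protocol = idleProtocol
    ; permute = λ _ σ → addBit t (get r (bits σ)) σ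
    ; involutive = λ b σ → trans
        (cong (λ z → addBit t z (addBit t (get r (bits σ)) σ)) (get-addBit t r _ σ t≢r))
        (addBit-cancel t _ σ) }
  layer (t += r · just i) (t≢r , t<) with f≤ i
  ... | s , s≤ , P , _ = record
    { pipes≤ = s≤ ; protocol = P
    ; permute = λ b σ → addBit t (get r (bits σ) ∧ b) σ
    ; involutive = λ b σ → trans
        (cong (λ z → addBit t (z ∧ b) (addBit t (get r (bits σ) ∧ b) σ)) (get-addBit t r _ σ t≢r))
        (addBit-cancel t _ σ) }

  layers : (p : Program k) → All (Admissible W) p → Layers
  layers []      []       = []
  layers (i ∷ p) (a ∷ as) = layer i a ∷ layers p as

  layer-correct : ∀ i (a : Admissible W i) x y σ →
    let ℓ = layer i a in
    bits (Layer.permute ℓ (output (Layer.protocol ℓ) x y) σ) ≈ step (λ i → f i x y) i (bits σ)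
  layer-correct (t += r · nothing) (t≢r , t<) x y σ =
    ≈-trans (bits-addBit t _ σ t<) (add-cong t (sym (∧-identityʳ _)) ≈-refl)
  layer-correct (t += r · just i) (t≢r , t<) x y σ with f≤ i
  ... | s , s≤ , P , computes =
    ≈-trans (bits-addBit t _ σ t<) (add-cong t (cong (get r (bits σ) ∧_) (computes x y)) ≈-refl)

  layers-correct : ∀ p (as : All (Admissible W) p) x y σ →
    bits (runLayers (layers p as) x y σ) ≈ run (λ i → f i x y) p (bits σ)
  layers-correct []      []       x y σ = ≈-refl
  layers-correct (i ∷ p) (a ∷ as) x y σ =
    ≈-trans (layers-correct p as x y _) (run-cong _ p (layer-correct i a x y σ))

  vertices≤ : ∀ q (ls : Layers) → vertices q ls ≤ q * 2 + length ls * (6 * q * suc c)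
  vertices≤ q []       = m≤m+n (q * 2) 0
  vertices≤ q (ℓ ∷ ls) = begin
    2 * (q * (3 * suc (Layer.pipes ℓ))) + vertices q ls
      ≤⟨ +-mono-≤ (*-monoʳ-≤ 2 (*-monoʳ-≤ q (*-monoʳ-≤ 3 (s≤s (Layer.pipes≤ ℓ))))) (vertices≤ q ls) ⟩
    2 * (q * (3 * suc c)) + (q * 2 + length ls * (6 * q * suc c))
      ≡⟨ solve 3 (λ q c l →
           con 2 :* (q :* (con 3 :* (con 1 :+ c))) :+ (q :* con 2 :+ l :* (con 6 :* q :* (con 1 :+ c)))
           := q :* con 2 :+ (con 1 :+ l) :* (con 6 :* q :* (con 1 :+ c))) refl q c (length ls) ⟩
    q * 2 + suc (length ls) * (6 * q * suc c) ∎
    where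
    open ≤-Reasoning
    open +-*-Solver using (solve; con; _:+_; _:*_; _:=_)

  length-layers : ∀ p (as : All (Admissible W) p) → length (layers p as) ≡ length p
  length-layers []      []       = refl
  length-layers (i ∷ p) (a ∷ as) = cong suc (length-layers p as)

treeBound : ∀ {X Y : Set} {k c} d j (t : Tree k) (f : Fin k → X → Y → Bool) → (∀ i → GH≤ (f i) c) →
  leaves t ≤ (2 ^ d) ^ j →
  let q = states (2 + codeLength d) in
  GH≤ (λ x y → value t (λ i → f i x y)) (q * 2 + (cost d j * leaves t + 1) * (6 * q * suc c))
treeBound {X} {Y} {k} {c} d j t f f≤ t≤ = GH≤-cong computes
  (network accepts (Fin↔State W) ls σ₀ (m≤n⇒m≤1+n (≤-trans (vertices≤ q ls)
    (+-monoʳ-≤ (q * 2) (*-monoˡ-≤ (6 * q * suc c) (≤-trans (≤-reflexive (length-layers _ C.admissible))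
      (≤-trans C.length≤ (≤-reflexive (cong (λ z → cost d j * z + 1) (+-identityʳ (leaves t)))))))))))
  where
  W = 2 + codeLength d
  q = states W
  open Simulation W f f≤
  open Network {X} {Y} {State W} {c} accepts
  -- Register 1 holds true and register 0 holds false in `σ₀`, so the chain adds 1 ∧ value t to an
  -- empty register.
  module C = Clean (cleanProgram d W ≤-refl j ((AND , t) ∷ []) 0 1 1
    (≤-trans (≤-reflexive (+-identityʳ _)) t≤) (λ ()) (λ ()) (s≤s z≤n))
  ls = layers C.program C.admissible
  zeros = replicate (codeLength d) false
  σ₀ : State W
  σ₀ = (false ∷ true ∷ zeros) , (false ∷ false ∷ zeros)
  computes : ∀ x y → accepts (runLayers ls x y σ₀) ≡ value t (λ i → f i x y)
  computes x y = trans (_≈_.first (layers-correct C.program C.admissible x y σ₀) 0)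
    (trans (_≈_.first (C.correct a (bit (proj₁ σ₀)) (bit (proj₂ σ₀))) 0) (∧-identityʳ (value t a)))
    where a = λ i → f i x y

-- Arithmetic of the bound

-- Adding the overhead D to the cost makes the recursion purely multiplicative: 4 K + D + D ≤ 4 (K +
-- D).
cost≤ : ∀ d j → cost d j + levelOverhead d ≤ 4 ^ j * (3 + levelOverhead d)
cost≤ d zero    = ≤-reflexive (sym (+-identityʳ _))
cost≤ d (suc j) = begin
  4 * K + D + D         ≡⟨ +-assoc (4 * K) D D ⟩
  4 * K + (D + D)       ≤⟨ +-monoʳ-≤ (4 * K) (+-monoʳ-≤ D (m≤m+n D (2 * D))) ⟩
  4 * K + (D + (D + 2 * D))
    ≡⟨ solve 2 (λ K D → con 4 :* K :+ (D :+ (D :+ con 2 :* D)) := con 4 :* (K :+ D)) refl K D ⟩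
  4 * (K + D)           ≤⟨ *-monoʳ-≤ 4 (cost≤ d j) ⟩
  4 * (4 ^ j * (3 + D)) ≡⟨ sym (*-assoc 4 (4 ^ j) (3 + D)) ⟩
  4 ^ suc j * (3 + D)   ∎
  where
  open ≤-Reasoning
  open +-*-Solver using (solve; con; _:+_; _:*_; _:=_)
  K = cost d j
  D = levelOverhead d

-- The exponent grows only when the old power is met exactly. The upper bound later limits the
-- factor 4 ^ j.
nearest-power : ∀ B → 2 ≤ B → ∀ s → ∃ λ j → suc s ≤ B ^ j × B ^ j ≤ B * suc s
nearest-power B 2≤B zero    = 0 , ≤-refl , ≤-trans (≤-trans (n≤1+n 1) 2≤B) (≤-reflexive (sym (*-identityʳ B)))
nearest-power B 2≤B (suc s) with nearest-power B 2≤B s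
... | j , s≤ , ≤Bs with suc (suc s) ≤? B ^ j
...   | yes s< = j , s< , ≤-trans ≤Bs (*-monoʳ-≤ B (n≤1+n (suc s)))
...   | no ¬s< = suc j , big , *-monoʳ-≤ B (≤-trans (≮⇒≥ ¬s<) (n≤1+n (suc s)))
  where
  big : suc (suc s) ≤ B * B ^ j
  big = ≤-trans (≤-reflexive (+-comm 1 (suc s)))
          (≤-trans (+-monoʳ-≤ (suc s) (s≤s z≤n)) (*-mono-≤ 2≤B s≤))

^-distribʳ-* : ∀ q m n → (m * n) ^ q ≡ m ^ q * n ^ q
^-distribʳ-* zero    m n = refl
^-distribʳ-* (suc q) m n = begin
  m * n * (m * n) ^ q       ≡⟨ cong (m * n *_) (^-distribʳ-* q m n) ⟩
  m * n * (m ^ q * n ^ q)   ≡⟨ *-interchange m n (m ^ q) (n ^ q) ⟩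
  m * m ^ q * (n * n ^ q)   ∎
  where
  open ≡-Reasoning
  open CommutativeSemigroupProperties *-commutativeSemigroup renaming (interchange to *-interchange)

linear-bound : ∀ d j c s → 1 ≤ c → 1 ≤ s →
  let q = states (2 + codeLength d) in
  q * 2 + (cost d j * s + 1) * (6 * q * suc c) ≤ 14 * q * (3 + levelOverhead d) * c * (s * 4 ^ j)
linear-bound d j (suc c′) (suc s′) _ _ = begin
  q * 2 + (K * s + 1) * (6 * q * suc c)
    ≤⟨ +-mono-≤ (*-monoʳ-≤ q (*-monoʳ-≤ 2 (s≤s (z≤n {c′ + s′ * c}))))
                (*-mono-≤ (+-monoʳ-≤ (K * s) (s≤s (z≤n {s′}))) (*-monoʳ-≤ (6 * q) (+-monoˡ-≤ c (s≤s (z≤n {c′}))))) ⟩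
  q * (2 * (s * c)) + (K * s + s) * (6 * q * (c + c))
    -- The added term rounds 12 K + 14 up to 14 (K + 1).
    ≤⟨ m≤m+n _ (2 * (q * (K * (s * c)))) ⟩
  q * (2 * (s * c)) + (K * s + s) * (6 * q * (c + c)) + 2 * (q * (K * (s * c)))
    ≡⟨ solve 4 (λ q K s c →
         q :* (con 2 :* (s :* c)) :+ (K :* s :+ s) :* (con 6 :* q :* (c :+ c))
           :+ con 2 :* (q :* (K :* (s :* c)))
         := con 14 :* q :* (K :+ con 1) :* c :* s) refl q K s c ⟩
  14 * q * (K + 1) * c * s
    ≤⟨ *-monoˡ-≤ s (*-monoˡ-≤ c (*-monoʳ-≤ (14 * q)
         (≤-trans (+-monoʳ-≤ K (≤-trans (s≤s z≤n) (m≤n+m 6 (8 * codeLength d)))) (cost≤ d j)))) ⟩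
  14 * q * (4 ^ j * (3 + D)) * c * s
    ≡⟨ solve 5 (λ q P D c s → con 14 :* q :* (P :* D) :* c :* s := con 14 :* q :* D :* c :* (s :* P))
         refl q (4 ^ j) (3 + D) c s ⟩
  14 * q * (3 + D) * c * (s * 4 ^ j) ∎
  where
  open ≤-Reasoning
  open +-*-Solver using (solve; con; _:+_; _:*_; _:=_)
  q = states (2 + codeLength d)
  K = cost d j
  D = levelOverhead d
  c = suc c′
  s = suc s′

-- With d = 2 q the factor 4 per level amounts to a factor 2 ^ d for the q-th
-- power, which is the factor by which the size shrinks.
power-bound : ∀ p q K c s j m → 1 ≤ p → 1 ≤ s → m ≤ K * c * (s * 4 ^ j) →
  (2 ^ (2 * q)) ^ j ≤ 2 ^ (2 * q) * s → m ^ q ≤ (4 * K * c) ^ q * s ^ (q + p)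
power-bound (suc p) q K c s@(suc _) j m _ _ m≤ j≤ = begin
  m ^ q                                 ≤⟨ ^-monoˡ-≤ q m≤ ⟩
  (K * c * (s * 4 ^ j)) ^ q             ≡⟨ ^-distribʳ-* q (K * c) (s * 4 ^ j) ⟩
  (K * c) ^ q * (s * 4 ^ j) ^ q         ≡⟨ cong ((K * c) ^ q *_) (^-distribʳ-* q s (4 ^ j)) ⟩
  (K * c) ^ q * (s ^ q * (4 ^ j) ^ q)   ≤⟨ *-monoʳ-≤ ((K * c) ^ q) (*-monoʳ-≤ (s ^ q) four) ⟩
  (K * c) ^ q * (s ^ q * (4 ^ q * (s * s ^ p)))
    ≡⟨ solve 4 (λ x y z w → x :* (y :* (z :* w)) := z :* x :* (y :* w)) refl
         ((K * c) ^ q) (s ^ q) (4 ^ q) (s ^ suc p) ⟩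
  4 ^ q * (K * c) ^ q * (s ^ q * s ^ suc p)
    ≡⟨ cong₂ _*_ (trans (sym (^-distribʳ-* q 4 (K * c))) (cong (_^ q) (sym (*-assoc 4 K c))))
                 (sym (^-distribˡ-+-* s q (suc p))) ⟩
  (4 * K * c) ^ q * s ^ (q + suc p) ∎
  where
  open ≤-Reasoning
  open +-*-Solver using (solve; con; _:+_; _:*_; _:=_)
  2^2q : 2 ^ (2 * q) ≡ 4 ^ q
  2^2q = sym (^-*-assoc 2 2 q)
  four : (4 ^ j) ^ q ≤ 4 ^ q * (s * s ^ p)
  four = begin
    (4 ^ j) ^ q       ≡⟨ trans (^-*-assoc 4 j q) (trans (cong (4 ^_) (*-comm j q)) (sym (^-*-assoc 4 q j))) ⟩
    (4 ^ q) ^ j       ≡⟨ cong (_^ j) (sym 2^2q) ⟩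
    (2 ^ (2 * q)) ^ j ≤⟨ j≤ ⟩
    2 ^ (2 * q) * s   ≡⟨ cong (_* s) 2^2q ⟩
    4 ^ q * s         ≤⟨ *-monoʳ-≤ (4 ^ q) (m≤m*n s (s ^ p) {{m^n≢0 s p}}) ⟩
    4 ^ q * (s * s ^ p) ∎

-- Here ε = p / q, and the inequality is raised to the q-th power to stay within ℕ.
theorem4 : (p q : ℕ) → 1 ≤ p → 1 ≤ q →
    Σ ℕ λ C →
    ∀ (k n s c : ℕ) (F : Formula k) → size F ≡ s →
    (f : Fin k → Vec Bool n → Vec Bool n → Bool) →
    (∀ i → GH≤ (f i) c) →
    Σ ℕ λ m → GH≤ (compose F f) m × (m ^ q ≤ (C * c) ^ q * s ^ (q + p))
theorem4 p q 1≤p 1≤q = 4 * K , bound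
  where
  d = 2 * q
  K = 14 * states (2 + codeLength d) * (3 + levelOverhead d)
  bound : ∀ (k n s c : ℕ) (F : Formula k) → size F ≡ s →
    (f : Fin k → Vec Bool n → Vec Bool n → Bool) → (∀ i → GH≤ (f i) c) →
    Σ ℕ λ m → GH≤ (compose F f) m × (m ^ q ≤ (4 * K * c) ^ q * s ^ (q + p))
  -- For c = 0 not a single pipe is allowed, so the simulation is out of reach; but then the
  -- composed function is constantly false.
  bound k n s zero F _ f f≤ =
    0 , (0 , z≤n , idleProtocol , λ x y → sym (trans (sym (value-binarise F _))
          (value-zero (binarise F) _ λ i → GH≤0-false (f≤ i) x y)))
      , ≤-trans (≤-reflexive (zero-power 1≤q)) z≤n
    where
    zero-power : ∀ {q} → 1 ≤ q → 0 ^ q ≡ 0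
    zero-power (s≤s _) = refl
  bound k n s c@(suc _) F refl f f≤ with leaves (binarise F) in eq | leaves-positive (binarise F)
  ... | suc s′ | _ with nearest-power (2 ^ d) (^-monoʳ-≤ 2 {1} {d} (≤-trans 1≤q (m≤m+n q _))) s′
  ...   | j , s≤ , ≤s =
    _ , GH≤-cong (λ x y → value-binarise F _) (treeBound d j (binarise F) f f≤ (≤-trans (≤-reflexive eq) s≤))
      , power-bound p q K c s j _ 1≤p 1≤s
          (≤-trans (≤-reflexive (cong size-bound ℓ≡)) (linear-bound d j c s (s≤s z≤n) 1≤s))
          (≤-trans ≤s (≤-reflexive (cong (2 ^ d *_) (trans (sym eq) ℓ≡))))
    where
    ℓ≡ = leaves-binarise F
    1≤s = ≤-trans (leaves-positive (binarise F)) (≤-reflexive ℓ≡)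
    size-bound : ℕ → ℕ
    size-bound z = states (2 + codeLength d) * 2
                 + (cost d j * z + 1) * (6 * states (2 + codeLength d) * suc c)
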